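{- Let $n$ be even. Then: (i) the number of species containing symmetric unipotent Latin squares of order $n$ equals the number of isotopism classes containing symmetric unipotent Latin squares of order $n$; (ii) the number of rrs-isotopism classes containing symmetric unipotent Latin squares of order $n$ equals the number of isomorphism classes of $1$-factorisations of the complete graph $K_n$; (iii) if $n\equiv 2\pmod 4$, then the number of species containing symmetric unipotent Latin squares of order $n$ equals the number of rrs-isotopism classes containing symmetric unipotent Latin squares of order $n$; (iv) the number of symmetric unipotent reduced Latin squares of order $n$ equals the number of symmetric idempotent Latin squares of order $n-1$, which in turn equals the number of symmetric reduced Latin squares of order $n-1$; (v) the number of symmetric unipotent Latin squares of order $n$ equals $n!$ times the number of symmetric reduced Latin squares of order $n-1$; (vi) the number of totally symmetric unipotent reduced Latin squares of order $n$ equals the number of totally symmetric idempotent Latin squares of order $n-1$; (vii) the number of isomorphism classes of symmetric unipotent Latin squares of order $n$ equals the number of isomorphism classes of symmetric Latin squares of order $n-1$; (viii) every species, isotopism class and rrs-isotopism class that contains a symmetric unipotent Latin square of order $n$ also contains a symmetric unipotent reduced Latin square.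
   Context: A Latin square of order $n$ is a set of $n^2$ triples (row, column, symbol) over $\{1,\dots,n\}$, distinct triples agreeing in at most one coordinate. It is symmetric if it equals its transpose; totally symmetric if it is unchanged by every uniform permutation of the three coordinates of its triples; reduced if its first row and column are $1,\dots,n$ in order; unipotent if all main diagonal entries are equal; idempotent if cell $(i,i)$ contains $i$ for all $i$. An isotopism $(\alpha,\beta,\gamma)\in\mathcal{S}_n^3$ maps $(r,c,s)$ to $(r^\alpha,c^\beta,s^\gamma)$; it is an rrs-isotopism if $\alpha=\beta$ and an isomorphism if $\alpha=\beta=\gamma$. A paratopism is an isotopism combined with a uniform permutation of the triple coordinates; species are paratopism classes. A class "containing" squares with a property means one containing at least one such square. A $1$-factorisation of $K_n$ is a partition of its edges into perfect matchings; two are isomorphic if a vertex bijection maps one to the other. -}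

module Defs where

open import Data.Nat using (ℕ; zero; suc)
open import Data.Fin using (Fin; zero; suc; toℕ)
open import Data.Fin.Permutation using (Permutation′; _⟨$⟩ʳ_; _⟨$⟩ˡ_)
open import Data.List using (List; length; lookup)
open import Data.Product using (Σ; ∃; _×_; _,_)
open import Relation.Binary.PropositionalEquality using (_≡_; _≢_)
open import Relation.Nullary using (¬_)

-- Latin squares
--
-- A square of order n is a filling of the n×n cells by symbols; its set of
-- triples is {(r, c, L r c)}.  It is Latin iff distinct triples agree in at
-- most one coordinate, i.e. each row and each column is injective.
-- Symbols/rows/columns are Fin n (0-based; "1" of the paper is Fin-zero).

Square : ℕ → Set
Square n = Fin n → Fin n → Fin n

IsLatin : ∀ {n} → Square n → Set
IsLatin {n} L = (∀ r c c′ → L r c ≡ L r c′ → c ≡ c′)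
              × (∀ r r′ c → L r c ≡ L r′ c → r ≡ r′)

Triple : ℕ → Set
Triple n = Fin 3 → Fin n

triple : ∀ {n} → Fin n → Fin n → Fin n → Triple n
triple r c s zero = r
triple r c s (suc zero) = c
triple r c s (suc (suc zero)) = s

_∈L_ : ∀ {n} → Triple n → Square n → Set
t ∈L L = L (t zero) (t (suc zero)) ≡ t (suc (suc zero))

conj : ∀ {n} → Permutation′ 3 → Triple n → Triple n
conj δ t i = t (δ ⟨$⟩ʳ i)

IsSymmetric : ∀ {n} → Square n → Set
IsSymmetric L = ∀ r c → L r c ≡ L c r

IsTotallySymmetric : ∀ {n} → Square n → Set
IsTotallySymmetric L = ∀ (δ : Permutation′ 3) (t : Triple _) → t ∈L L → conj δ t ∈L L

IsReduced : ∀ {n} → Square n → Set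
IsReduced {n} L = ∀ (z : Fin n) → toℕ z ≡ 0 → ∀ i → (L z i ≡ i) × (L i z ≡ i)

IsUnipotent : ∀ {n} → Square n → Set
IsUnipotent L = ∀ i j → L i i ≡ L j j

IsIdempotent : ∀ {n} → Square n → Set
IsIdempotent L = ∀ i → L i i ≡ i

SameSquare : ∀ {n} → Square n → Square n → Set
SameSquare L₁ L₂ = ∀ r c → L₁ r c ≡ L₂ r c

IsotopismMaps : ∀ {n} → Permutation′ n → Permutation′ n → Permutation′ n
              → Square n → Square n → Set
IsotopismMaps α β γ L₁ L₂ =
  ∀ r c → L₂ (α ⟨$⟩ʳ r) (β ⟨$⟩ʳ c) ≡ γ ⟨$⟩ʳ (L₁ r c)

Isotopic : ∀ {n} → Square n → Square n → Set
Isotopic {n} L₁ L₂ = Σ (Permutation′ n) λ α → Σ (Permutation′ n) λ β →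
  Σ (Permutation′ n) λ γ → IsotopismMaps α β γ L₁ L₂

RRSIsotopic : ∀ {n} → Square n → Square n → Set
RRSIsotopic {n} L₁ L₂ = Σ (Permutation′ n) λ α →
  Σ (Permutation′ n) λ γ → IsotopismMaps α α γ L₁ L₂

Isomorphic : ∀ {n} → Square n → Square n → Set
Isomorphic {n} L₁ L₂ = Σ (Permutation′ n) λ α → IsotopismMaps α α α L₁ L₂

-- paratopism: isotopism (α,β,γ) followed by a uniform permutation δ of the
-- coordinates; it maps every triple of L₁ to a triple of L₂ (hence, both
-- being Latin squares with n² triples, maps L₁ onto L₂)
Paratopic : ∀ {n} → Square n → Square n → Set
Paratopic {n} L₁ L₂ = Σ (Permutation′ 3) λ δ → Σ (Permutation′ n) λ α →
  Σ (Permutation′ n) λ β → Σ (Permutation′ n) λ γ →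
  ∀ r c → conj δ (triple (α ⟨$⟩ʳ r) (β ⟨$⟩ʳ c) (γ ⟨$⟩ʳ (L₁ r c))) ∈L L₂

-- Counting classes.
--
-- NumClasses P R k : the number of R-classes of Latin squares of order n
-- containing at least one square with property P is k.  Witnessed by a
-- list of k Latin P-squares (representatives), pairwise not R-related,
-- such that every Latin P-square is R-related to one of them.
-- With R = SameSquare this is just the number of Latin P-squares.

NumClasses : (n : ℕ) → (Square n → Set) → (Square n → Square n → Set) → ℕ → Set
NumClasses n P R k = Σ (List (Square n)) λ reps →
    (length reps ≡ k)
  × (∀ i → IsLatin (lookup reps i) × P (lookup reps i))
  × (∀ i j → R (lookup reps i) (lookup reps j) → i ≡ j)
  × (∀ L → IsLatin L → P L → ∃ λ i → R L (lookup reps i))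

_∧_ : ∀ {n} → (Square n → Set) → (Square n → Set) → Square n → Set
(P ∧ Q) L = P L × Q L
infixr 4 _∧_

-- a perfect matching of K_n, as a fixed-point-free involution m
-- (edge {u, m u} for each u)
IsPerfectMatching : ∀ {n} → (Fin n → Fin n) → Set
IsPerfectMatching m = (∀ u → m (m u) ≡ u) × (∀ u → m u ≢ u)

IsOneFactorisation : ∀ {n} → List (Fin n → Fin n) → Set
IsOneFactorisation {n} F =
    (∀ i → IsPerfectMatching (lookup F i))
  × (∀ (u v : Fin n) → u ≢ v → ∃ λ i → lookup F i u ≡ v)
  × (∀ (u v : Fin n) → ∀ i j → lookup F i u ≡ v → lookup F j u ≡ v → i ≡ j)

-- image of a matching under a vertex bijection φ: edge {u,v} ↦ {φu,φv}
mapMatching : ∀ {n} → Permutation′ n → (Fin n → Fin n) → Fin n → Fin n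
mapMatching φ m x = φ ⟨$⟩ʳ (m (φ ⟨$⟩ˡ x))

IsomorphicOF : ∀ {n} → List (Fin n → Fin n) → List (Fin n → Fin n) → Set
IsomorphicOF {n} F₁ F₂ = Σ (Permutation′ n) λ φ →
    (∀ i → ∃ λ j → ∀ x → mapMatching φ (lookup F₁ i) x ≡ lookup F₂ j x)
  × (∀ j → ∃ λ i → ∀ x → mapMatching φ (lookup F₁ i) x ≡ lookup F₂ j x)

NumOneFactorisationClasses : ℕ → ℕ → Set
NumOneFactorisationClasses n k = Σ (List (List (Fin n → Fin n))) λ reps →
    (length reps ≡ k)
  × (∀ i → IsOneFactorisation (lookup reps i))
  × (∀ i j → IsomorphicOF (lookup reps i) (lookup reps j) → i ≡ j)
  × (∀ F → IsOneFactorisation F → ∃ λ i → IsomorphicOF F (lookup reps i))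

{-# OPTIONS --safe #-}
module Submission where

-- Paratopic symmetric squares L₁, L₂ are isotopic: the symmetry of L₂, pulled back along a
-- paratopism that moves the symbol coordinate, is an autoparatopism of L₁ which together with
-- the symmetry of L₁ realises every permutation of the coordinates.  An isotopism (α, β, γ)
-- between symmetric squares makes θ = α⁻¹β satisfy L₁(θr, c) = L₁(r, θc); unipotency gives
-- θ² = 1, and θ is the identity or has no fixed point.  In the latter case, if 4 ∤ n, each
-- symbol off the main diagonal lies in some cell (x, θx), since otherwise θ and the perfect
-- matching given by that symbol would generate a group of order 4 acting freely; but the cells
-- (x, θx) carry at most n/2 symbols, so n = 2.
--
-- The symbols off the diagonal of a symmetric unipotent square are the factors of a
-- 1-factorisation.  In a symmetric Latin square of odd order every symbol is on the diagonal, so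
-- the diagonal can be moved to a new row and column and replaced by a new symbol: this turns
-- symmetric squares of order n − 1 into symmetric unipotent ones of order n, and idempotent
-- squares into reduced ones.  Permuting symbols accounts for the remaining bijections.

open import Defs
open import Data.Bool using (Bool; true; false; not; if_then_else_)
open import Data.Bool.Properties using (¬-not; not-involutive; not-¬) renaming (_≟_ to _≟ᵇ_)
open import Data.Fin as Fin
  using (Fin; zero; suc; cast; combine; remQuot; punchIn; punchOut; splitAt; join)
open import Data.Fin.Permutation as Perm
  using (Permutation′; permutation; _⟨$⟩ʳ_; _⟨$⟩ˡ_; _≈_; _∘ₚ_; flip; insert; remove;
    insert-remove; inverseˡ; inverseʳ; lift₀; lift₀-remove; transpose; Permutation)
open import Data.Fin.Properties
  using (_≟_; any?; all?; injective⇒≤; punchIn-injective; punchOut-injective; remQuot-combine;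
    combine-remQuot; cast-involutive; _<?_; <-asym; <-cmp; suc-injective; punchIn-punchOut;
    punchInᵢ≢i; join-splitAt)
open import Data.List using (List; length; lookup; tabulate)
open import Data.List.Properties using (length-tabulate; lookup-tabulate)
open import Data.Nat using (ℕ; zero; suc; _*_; _^_; _!; _+_; _%_; _≤_; s≤s; _<_; _∸_)
open import Data.Nat.Divisibility using (_∣_; divides; n∣m⇒m%n≡0; ∣m+n∣m⇒∣n; ∣1⇒≡1)
open import Data.Nat.Properties
  using (+-0-commutativeMonoid; 1+n≰n; +-identityʳ; *-comm; *-assoc; m≤n+m; ≤-trans; +-comm)
open import Data.Product using (Σ; ∃; _×_; _,_; proj₁; proj₂)
open import Data.Sum using (_⊎_; inj₁; inj₂)
open import Data.Unit using (⊤; tt)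
open import Function using (_∘_; case_of_)
open import Function.Bundles using (Injection)
open import Function.Properties.Inverse using (↔⇒↣)
open import Relation.Binary using (tri<; tri≈; tri>)
open import Relation.Binary.PropositionalEquality
  using (_≡_; _≢_; refl; sym; trans; cong; cong₂; subst; module ≡-Reasoning)
open import Relation.Nullary using (¬_; Dec; yes; no; contradiction; does)
open import Relation.Nullary.Decidable using (map′; _×-dec_; _→-dec_; dec-true; dec-false)
open import Algebra.Properties.CommutativeMonoid.Sum +-0-commutativeMonoid
  using (sum; sum-cong-≗; sum-permute; ∑-distrib-+)

-- Counting the classes of a relation

-- NumClasses over an arbitrary carrier; being a record, it lets P and R be inferred.
record Count {A : Set} (P : A → Set) (R : A → A → Set) (k : ℕ) : Set where
  constructor mkCount
  field
    rep      : Fin k → A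
    rep-P    : ∀ i → P (rep i)
    rep-≉    : ∀ i j → R (rep i) (rep j) → i ≡ j
    rep-hits : ∀ a → P a → ∃ λ i → R a (rep i)

Everything : {A : Set} → A → Set
Everything _ = ⊤

module _ {A B : Set} {P : A → Set} {R : A → A → Set} {Q : B → Set} {S : B → B → Set} where

  -- Images of representatives are again representatives. The last condition on `f` combines
  -- surjectivity with compatibility: `b` is related to the image of every member of the class of
  -- `a`, in particular to that of its representative.
  count-transfer : ∀ {k} (f : ∀ a → P a → B) →
    (∀ a p → Q (f a p)) →
    (∀ {a a′} p p′ → S (f a p) (f a′ p′) → R a a′) →
    (∀ b → Q b → ∃ λ a → P a × (∀ a′ p′ → R a a′ → S b (f a′ p′))) →
    Count P R k → Count Q S k
  count-transfer f pres reflects surj (mkCount r rP rR rc) = mkCount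
    (λ i → f (r i) (rP i))
    (λ i → pres (r i) (rP i))
    (λ i j s → rR i j (reflects (rP i) (rP j) s))
    (λ b q → let (a , p , h) = surj b q ; (i , ri) = rc a p in i , h (r i) (rP i) ri)

  count-× : ∀ {k l} → Count P R k → Count Q S l →
    Count {A × B} (λ (a , b) → P a × Q b) (λ (a , b) (a′ , b′) → R a a′ × S b b′) (k * l)
  count-× {k} {l} (mkCount r rP rR rc) (mkCount s sQ sS sc) = mkCount
    rs
    (λ i → rP _ , sQ _)
    (λ i j (x , y) → trans (sym (combine-remQuot {k} l i))
      (trans (cong₂ combine (rR _ _ x) (sS _ _ y)) (combine-remQuot {k} l j)))
    (λ (a , b) (p , q) → let (i , x) = rc a p ; (j , y) = sc b q in
      combine i j , subst (λ (i , j) → R a (r i) × S b (s j)) (sym (remQuot-combine i j)) (x , y))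
    where
    rs : Fin (k * l) → A × B
    rs i = r (proj₁ (remQuot {k} l i)) , s (proj₂ (remQuot {k} l i))

count-cong : ∀ {A : Set} {P : A → Set} {R S : A → A → Set} {k} →
  (∀ {a a′} → P a → P a′ → R a a′ → S a a′) → (∀ {a a′} → P a → P a′ → S a a′ → R a a′) →
  Count P R k → Count P S k
count-cong R⇒S S⇒R = count-transfer (λ a _ → a) (λ _ p → p) S⇒R
  (λ a p → a , p , λ a′ p′ → R⇒S p p′)

count-Fin : ∀ n → Count {Fin n} Everything _≡_ n
count-Fin n = mkCount (λ i → i) (λ _ → tt) (λ _ _ eq → eq) (λ i _ → i , refl)

count-functions : ∀ {A : Set} {R : A → A → Set} {k} n → Count Everything R k →
  Count {Fin n → A} Everything (λ f g → ∀ i → R (f i) (g i)) (k ^ n)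
count-functions zero _ = mkCount (λ _ ()) (λ _ → tt) (λ { zero zero _ → refl }) (λ _ _ → zero , λ ())
count-functions {A} {R} (suc n) c = count-transfer {R = λ (a , f) (b , g) → R a b × (∀ i → R (f i) (g i))}
  (λ x _ → cons x) (λ _ _ → tt) (λ _ _ h → h zero , h ∘ suc)
  (λ f _ → (f zero , f ∘ suc) , (tt , tt) , λ _ _ (h₀ , h) → λ { zero → h₀ ; (suc i) → h i })
  (count-× c (count-functions n c))
  where
  cons : A × (Fin n → A) → Fin (suc n) → A
  cons (a , f) zero = a
  cons (a , f) (suc i) = f i

-- The image of `zero` can be chosen in `suc n` ways, and deleting it leaves a permutation of `n`
-- points.
count-permutations : ∀ n → Count {Permutation′ n} Everything _≈_ (n !)
count-permutations zero = mkCount (λ _ → Perm.id) (λ _ → tt) (λ { zero zero _ → refl }) (λ _ _ → zero , λ ())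
count-permutations (suc n) = count-transfer {R = λ (i , π) (j , ρ) → i ≡ j × π ≈ ρ}
  (λ (j , π) _ → insert zero j π) (λ _ _ → tt)
  (λ { {i , π} {j , ρ} _ _ h → h zero ,
       λ k → punchIn-injective i _ _ (trans (h (suc k)) (cong (λ l → punchIn l (ρ ⟨$⟩ʳ k)) (sym (h zero)))) })
  (λ π _ → (π ⟨$⟩ʳ zero , remove zero π) , (tt , tt) ,
    λ { (j , ρ) _ (refl , h) k → trans (sym (insert-remove zero π k)) (insert-cong (remove zero π) ρ h k) })
  (count-× (count-Fin (suc n)) (count-permutations n))
  where
  insert-cong : ∀ {j} (π ρ : Permutation′ n) → π ≈ ρ → insert zero j π ≈ insert zero j ρ
  insert-cong π ρ h zero = refl
  insert-cong {j} π ρ h (suc k) = cong (punchIn j) (h k)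

-- Existence of class numbers

module _ {A : Set} {P : A → Set} {R : A → A → Set}
         (P? : ∀ a → Dec (P a)) (R? : ∀ a b → Dec (R a b))
         (R-refl : ∀ {a} → R a a) (R-sym : ∀ {a b} → R a b → R b a) where

  -- Greedy selection along `g`: a value satisfying `P` is kept exactly when it is related to none
  -- of those already kept.
  representatives : ∀ K (g : Fin K → A) → ∃ λ k → Σ (Fin k → A) λ f →
      (∀ i → P (f i))
    × (∀ i j → R (f i) (f j) → i ≡ j)
    × (∀ x → P (g x) → ∃ λ i → R (g x) (f i))
  representatives zero g = zero , (λ ()) , (λ ()) , (λ ()) , λ ()
  representatives (suc K) g with representatives K (g ∘ suc) | P? (g zero)
  ... | k , f , fP , fR , fc | no ¬p = k , f , fP , fR ,
        λ { zero p → contradiction p ¬p ; (suc x) p → fc x p }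
  ... | k , f , fP , fR , fc | yes p with any? (λ i → R? (g zero) (f i))
  ...   | yes old = k , f , fP , fR , λ { zero _ → old ; (suc x) q → fc x q }
  ...   | no new = suc k , f′ , (λ { zero → p ; (suc i) → fP i }) ,
            (λ { zero zero _ → refl
               ; zero (suc j) r → contradiction (j , r) new
               ; (suc i) zero r → contradiction (i , R-sym r) new
               ; (suc i) (suc j) r → cong suc (fR i j r) }) ,
            λ { zero _ → zero , R-refl ; (suc x) q → let (i , r) = fc x q in suc i , r }
    where
    f′ : Fin (suc k) → A
    f′ zero = g zero
    f′ (suc i) = f i

  -- A finite list meeting every class of the finer relation `_∼_` also meets every class of `R`, so
  -- greedy selection from that list suffices.
  count-exists : ∀ {_∼_ : A → A → Set} {K} → Count Everything _∼_ K →
    (∀ {a b} → a ∼ b → P a → P b) → (∀ {a b} → a ∼ b → R a b) →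
    (∀ {a b c} → R a b → R b c → R a c) → ∃ (Count P R)
  count-exists {K = K} (mkCount g _ _ gc) P-resp ∼⇒R R-trans =
    let (k , f , fP , fR , fc) = representatives K g in
    k , mkCount f fP fR λ a p →
      let (x , a∼x) = gc a tt ; (i , r) = fc x (P-resp a∼x p) in i , R-trans (∼⇒R a∼x) r

-- Up to pointwise equality only `n !` candidates have to be tried.
∃-permutation? : ∀ {n} {P : Permutation′ n → Set} → (∀ π → Dec (P π)) →
  (∀ {π ρ} → π ≈ ρ → P π → P ρ) → Dec (∃ P)
∃-permutation? {n} P? resp with count-permutations n
... | mkCount f _ _ fc = map′ (λ (i , p) → f i , p)
  (λ (π , p) → let (i , h) = fc π tt in i , resp h p) (any? (P? ∘ f))

-- Passage from indexed families to lists of representatives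

module _ {A : Set} {k} (f : Fin k → A) where

  -- The length of `tabulate f` equals `k` only propositionally, so indices are carried across by a
  -- cast.
  tabulate-index : Fin (length (tabulate f)) → Fin k
  tabulate-index = cast (length-tabulate f)

  tabulate-index⁻¹ : Fin k → Fin (length (tabulate f))
  tabulate-index⁻¹ = cast (sym (length-tabulate f))

  tabulate-index-injective : ∀ {i j} → tabulate-index i ≡ tabulate-index j → i ≡ j
  tabulate-index-injective {i} {j} eq = trans (sym (inv i)) (trans (cong tabulate-index⁻¹ eq) (inv j))
    where
    inv : ∀ i → tabulate-index⁻¹ (tabulate-index i) ≡ i
    inv = cast-involutive (sym (length-tabulate f)) (length-tabulate f)

  lookup-tabulate′ : ∀ i → lookup (tabulate f) i ≡ f (tabulate-index i)
  lookup-tabulate′ i = trans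
    (cong (lookup (tabulate f)) (sym (cast-involutive (sym (length-tabulate f)) (length-tabulate f) i)))
    (lookup-tabulate f (tabulate-index i))

  tabulate-reps : {P : A → Set} {R : A → A → Set} →
    (∀ i → P (f i)) → (∀ i j → R (f i) (f j) → i ≡ j) → (∀ a → P a → ∃ λ i → R a (f i)) →
    let reps = tabulate f in
      (length reps ≡ k)
    × (∀ i → P (lookup reps i))
    × (∀ i j → R (lookup reps i) (lookup reps j) → i ≡ j)
    × (∀ a → P a → ∃ λ i → R a (lookup reps i))
  tabulate-reps {P} {R} fP fR fc =
      length-tabulate f
    , (λ i → subst P (sym (lookup-tabulate′ i)) (fP _))
    , (λ i j r → tabulate-index-injective (fR _ _ (subst (λ a → R a _) (lookup-tabulate′ i)
                   (subst (R _) (lookup-tabulate′ j) r))))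
    , λ a p → let (i , r) = fc a p in tabulate-index⁻¹ i , subst (R a) (sym (lookup-tabulate f i)) r

count⇒NumClasses : ∀ {n P R k} → Count (λ L → IsLatin L × P L) R k → NumClasses n P R k
count⇒NumClasses {P = P} {R} (mkCount f fP fR fc) =
  let (len , p , r , c) = tabulate-reps f {λ L → IsLatin L × P L} {R} fP fR fc in
  tabulate f , len , p , r , λ L l q → c L (l , q)

count⇒NumOneFactorisationClasses : ∀ {n k} →
  Count IsOneFactorisation IsomorphicOF k → NumOneFactorisationClasses n k
count⇒NumOneFactorisationClasses (mkCount f fP fR fc) =
  tabulate f , tabulate-reps f {IsOneFactorisation} {IsomorphicOF} fP fR fc

-- Injections, free involutions and divisibility

permutation-injective : ∀ {n} (π : Permutation′ n) {i j} → π ⟨$⟩ʳ i ≡ π ⟨$⟩ʳ j → i ≡ j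
permutation-injective π = Injection.injective (↔⇒↣ π)

-- If `y` were missed, punching it out would inject `suc n` points into `n`.
injective⇒surjective : ∀ {n} (f : Fin n → Fin n) → (∀ {i j} → f i ≡ f j → i ≡ j) → ∀ y → ∃ λ x → f x ≡ y
injective⇒surjective {suc n} f inj y with any? (λ x → f x ≟ y)
... | yes hit = hit
... | no miss = contradiction (injective⇒≤ {f = λ x → punchOut (y≢f x)}
        (inj ∘ punchOut-injective (y≢f _) (y≢f _))) 1+n≰n
  where
  y≢f : ∀ x → y ≢ f x
  y≢f x eq = miss (x , sym eq)

injective⇒permutation : ∀ {n} (f : Fin n → Fin n) → (∀ {i j} → f i ≡ f j → i ≡ j) → Permutation′ n
injective⇒permutation f inj = permutation f (proj₁ ∘ surj) (proj₂ ∘ surj) (λ x → inj (proj₂ (surj (f x))))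
  where surj = injective⇒surjective f inj

sum-ones : ∀ n → sum {n} (λ _ → 1) ≡ n
sum-ones zero = refl
sum-ones (suc n) = cong suc (sum-ones n)

module FreeInvolution {n} (σ : Fin n → Fin n) (invol : ∀ x → σ (σ x) ≡ x) (free : ∀ x → σ x ≢ x) where

  -- Marks one point of each orbit of `σ`, the smaller one.
  isLower : Fin n → Bool
  isLower x = does (x <? σ x)

  isLower-σ : ∀ x → isLower (σ x) ≡ not (isLower x)
  isLower-σ x with <-cmp x (σ x)
  ... | tri< p _ _ = trans (dec-false (σ x <? σ (σ x)) λ q → <-asym p (subst (σ x Fin.<_) (invol x) q))
                           (cong not (sym (dec-true (x <? σ x) p)))
  ... | tri≈ _ e _ = contradiction (sym e) (free x)
  ... | tri> ¬p _ q = trans (dec-true (σ x <? σ (σ x)) (subst (σ x Fin.<_) (sym (invol x)) q))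
                            (cong not (sym (dec-false (x <? σ x) ¬p)))

  lower : (Fin n → ℕ) → Fin n → ℕ
  lower w x = if isLower x then w x else 0

  -- Each orbit has two points of equal weight, exactly one of them lower. A general weight allows a
  -- second halving, applied to the indicator of the points that are lower for another involution.
  sum-halves : ∀ w → (∀ x → w (σ x) ≡ w x) → sum w ≡ 2 * sum (lower w)
  sum-halves w w-σ = begin
    sum w                                        ≡⟨ sum-cong-≗ split ⟩
    sum (λ x → lower w x + lower w (σ x))        ≡⟨ ∑-distrib-+ (lower w) (lower w ∘ σ) ⟩
    sum (lower w) + sum (lower w ∘ σ)            ≡⟨ cong (sum (lower w) +_)
                                                      (sum-permute (lower w) (permutation σ σ invol invol)) ⟨
    sum (lower w) + sum (lower w)                ≡⟨ cong (sum (lower w) +_) (+-identityʳ _) ⟨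
    2 * sum (lower w)                            ∎
    where
    open ≡-Reasoning
    split : ∀ x → w x ≡ lower w x + lower w (σ x)
    split x rewrite isLower-σ x with isLower x
    ... | true = sym (+-identityʳ _)
    ... | false = sym (w-σ x)

  order-even : 2 ∣ n
  order-even = divides half (trans (sym (sum-ones n)) (trans (sum-halves (λ _ → 1) (λ _ → refl)) (*-comm 2 half)))
    where half = sum (lower (λ _ → 1))

-- μ induces a free involution ν on the points below their θ-image.
four-divides : ∀ {n} (θ μ : Fin n → Fin n) →
  (∀ x → θ (θ x) ≡ x) → (∀ x → θ x ≢ x) → (∀ x → μ (μ x) ≡ x) → (∀ x → μ x ≢ x) →
  (∀ x → μ (θ x) ≡ θ (μ x)) → (∀ x → μ x ≢ θ x) → 4 ∣ n
four-divides {n} θ μ θθ θ-free μμ μ-free comm μ≢θ = divides quarter (begin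
  n                                       ≡⟨ sum-ones n ⟨
  sum {n} (λ _ → 1)                       ≡⟨ T.sum-halves (λ _ → 1) (λ _ → refl) ⟩
  2 * sum weight                          ≡⟨ cong (2 *_) (V.sum-halves weight λ x → cong (if_then 1 else 0) (ν-lower x)) ⟩
  2 * (2 * quarter)          ≡⟨ *-assoc 2 2 quarter ⟨
  4 * quarter                ≡⟨ *-comm 4 quarter ⟩
  quarter * 4                ∎)
  where
  open ≡-Reasoning
  module T = FreeInvolution θ θθ θ-free

  weight : Fin n → ℕ
  weight = T.lower (λ _ → 1)

  ν : Fin n → Fin n
  -- `μ x` and `θ (μ x)` lie on opposite sides of `θ`; the one on the same side as `x` is chosen.
  ν x = if does (T.isLower x ≟ᵇ T.isLower (μ x)) then μ x else θ (μ x)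

  ν-cases : ∀ x → (T.isLower (μ x) ≡ T.isLower x × ν x ≡ μ x)
                ⊎ (T.isLower (μ x) ≡ not (T.isLower x) × ν x ≡ θ (μ x))
  ν-cases x with T.isLower x ≟ᵇ T.isLower (μ x)
  ... | yes p = inj₁ (sym p , refl)
  ... | no ¬p = inj₂ (¬-not (¬p ∘ sym) , refl)

  ν-lower : ∀ x → T.isLower (ν x) ≡ T.isLower x
  ν-lower x with ν-cases x
  ... | inj₁ (p , q) = trans (cong T.isLower q) p
  ... | inj₂ (p , q) = trans (cong T.isLower q) (trans (T.isLower-σ (μ x)) (trans (cong not p) (not-involutive _)))

  ν-involutive : ∀ x → ν (ν x) ≡ x
  ν-involutive x with ν-cases x | ν-cases (ν x)
  ... | inj₁ (p , q) | inj₁ (p′ , q′) = trans q′ (trans (cong μ q) (μμ x))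
  -- The mixed cases are impossible: `μ (ν x)` is `x` here and `θ x` in the next case, and each lies
  -- on the wrong side for the case assumed.
  ... | inj₁ (p , q) | inj₂ (p′ , q′) = contradiction
        (trans (trans (sym p) (sym (cong T.isLower q)))
          (trans (sym (not-involutive _)) (trans (cong not (sym p′))
            (cong (not ∘ T.isLower) (trans (cong μ q) (μμ x))))))
        (not-¬ refl)
  ... | inj₂ (p , q) | inj₁ (p′ , q′) = contradiction
        (trans (sym (ν-lower x)) (trans (sym p′)
          (trans (cong T.isLower (trans (cong μ q) (trans (comm (μ x)) (cong θ (μμ x))))) (T.isLower-σ x))))
        (not-¬ refl)
  ... | inj₂ (p , q) | inj₂ (p′ , q′) =
        trans q′ (trans (cong (θ ∘ μ) q) (trans (cong θ (trans (comm (μ x)) (cong θ (μμ x)))) (θθ x)))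

  ν-free : ∀ x → ν x ≢ x
  ν-free x e with ν-cases x
  ... | inj₁ (_ , q) = μ-free x (trans (sym q) e)
  ... | inj₂ (_ , q) = μ≢θ x (trans (sym (θθ (μ x))) (cong θ (trans (sym q) e)))

  module V = FreeInvolution ν ν-involutive ν-free

  quarter : ℕ
  quarter = sum (V.lower weight)

-- A section of `f` is injective, hence surjective, so it is a two-sided inverse.
surjective⇒injective : ∀ {n} (f : Fin n → Fin n) → (∀ y → ∃ λ x → f x ≡ y) → ∀ {i j} → f i ≡ f j → i ≡ j
surjective⇒injective f surj {i} {j} eq =
  let (a , ga≡i) = hit i ; (b , gb≡j) = hit j
      a≡b = trans (sym (proj₂ (surj a))) (trans (cong f ga≡i) (trans eq (trans (cong f (sym gb≡j)) (proj₂ (surj b)))))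
  in trans (sym ga≡i) (trans (cong (proj₁ ∘ surj) a≡b) gb≡j)
  where
  hit : ∀ y → ∃ λ x → proj₁ (surj x) ≡ y
  hit = injective⇒surjective (proj₁ ∘ surj)
    (λ {a} {b} e → trans (sym (proj₂ (surj a))) (trans (cong f e) (proj₂ (surj b))))

-- Rows, symbols and relabellings of Latin squares

private variable
  n m : ℕ
  L L₁ L₂ L₃ : Square n

module _ {L : Square n} (lat : IsLatin L) where

  row : Fin n → Permutation′ n
  row r = injective⇒permutation (L r) (proj₁ lat r _ _)

  -- The position of `s` in row `r`. In a symmetric square, for fixed `s`, it is the involution on
  -- indices that pairs each cell holding `s` with its transpose.
  column : Fin n → Fin n → Fin n
  column r s = row r ⟨$⟩ˡ s

  L-column : ∀ r s → L r (column r s) ≡ s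
  L-column r s = inverseʳ (row r)

  column-unique : ∀ {r c s} → L r c ≡ s → column r s ≡ c
  column-unique {r} {c} {s} eq = proj₁ lat r _ _ (trans (L-column r s) (sym eq))

  column-involutive : IsSymmetric L → ∀ s r → column (column r s) s ≡ r
  column-involutive symL s r = column-unique (trans (symL _ r) (L-column r s))

  -- The cells off the diagonal holding s are paired by transposition.
  diagonal-surjective : IsSymmetric L → ¬ 2 ∣ n → ∀ s → ∃ λ i → L i i ≡ s
  diagonal-surjective symL odd s with any? (λ i → L i i ≟ s)
  ... | yes hit = hit
  ... | no miss = contradiction
        (FreeInvolution.order-even (λ r → column r s) (column-involutive symL s)
          (λ r e → miss (r , trans (cong (L r) (sym e)) (L-column r s))))
        odd

  diagonal-injective : IsSymmetric L → ¬ 2 ∣ n → ∀ {i j} → L i i ≡ L j j → i ≡ j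
  diagonal-injective symL odd = surjective⇒injective (λ i → L i i) (diagonal-surjective symL odd)

symmetric⇒latin : IsSymmetric L → (∀ r c c′ → L r c ≡ L r c′ → c ≡ c′) → IsLatin L
symmetric⇒latin symL rows = rows , λ r r′ c eq → rows c r r′ (trans (symL c r) (trans eq (symL r′ c)))

relabel : Permutation′ n → Square n → Square n
relabel γ L r c = γ ⟨$⟩ʳ L r c

relabel-latin : (γ : Permutation′ n) → IsLatin L → IsLatin (relabel γ L)
relabel-latin γ (rows , cols) =
  (λ r c c′ → rows r c c′ ∘ permutation-injective γ) , λ r r′ c → cols r r′ c ∘ permutation-injective γ

relabel-symmetric : (γ : Permutation′ n) → IsSymmetric L → IsSymmetric (relabel γ L)
relabel-symmetric γ symL r c = cong (γ ⟨$⟩ʳ_) (symL r c)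

relabel-unipotent : (γ : Permutation′ n) → IsUnipotent L → IsUnipotent (relabel γ L)
relabel-unipotent γ uni i j = cong (γ ⟨$⟩ʳ_) (uni i j)

relabel-injective : (γ γ′ : Permutation′ n) → γ ≈ γ′ →
  SameSquare (relabel γ L₁) (relabel γ′ L₂) → SameSquare L₁ L₂
relabel-injective γ γ′ γ≈γ′ same r c =
  permutation-injective γ (trans (same r c) (sym (γ≈γ′ _)))

-- Renaming symbols by the inverse of the first row makes that row the identity, and rows and
-- columns stay in place.
normalise : {L : Square (suc n)} → IsLatin L → Square (suc n)
normalise {L = L} lat = relabel (flip (row lat zero)) L

normalise-latin : {L : Square (suc n)} (lat : IsLatin L) → IsLatin (normalise lat)
normalise-latin lat = relabel-latin (flip (row lat zero)) lat

normalise-symmetric : {L : Square (suc n)} (lat : IsLatin L) → IsSymmetric L → IsSymmetric (normalise lat)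
normalise-symmetric lat = relabel-symmetric (flip (row lat zero))

normalise-unipotent : {L : Square (suc n)} (lat : IsLatin L) → IsUnipotent L → IsUnipotent (normalise lat)
normalise-unipotent {L = L} lat = relabel-unipotent {L = L} (flip (row lat zero))

normalise-reduced : {L : Square (suc n)} (lat : IsLatin L) → IsSymmetric L → IsReduced (normalise lat)
normalise-reduced lat symL zero _ i = column-unique lat refl , column-unique lat (symL zero i)

-- Bordered squares

-- Old symbols are shifted by `suc`, which frees `zero` for the new diagonal.
border : Square m → Square (suc m)
border M zero zero = zero
border M zero (suc j) = suc (M j j)
border M (suc i) zero = suc (M i i)
border M (suc i) (suc j) with i ≟ j
... | yes _ = zero
... | no _ = suc (M i j)

module _ (M : Square m) where

  border-diagonal : ∀ i → border M i i ≡ zero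
  border-diagonal zero = refl
  border-diagonal (suc i) with i ≟ i
  ... | yes _ = refl
  ... | no i≢i = contradiction refl i≢i

  border-interior : ∀ {i j} → i ≢ j → border M (suc i) (suc j) ≡ suc (M i j)
  border-interior {i} {j} i≢j with i ≟ j
  ... | yes i≡j = contradiction i≡j i≢j
  ... | no _ = refl

  border-unipotent : IsUnipotent (border M)
  border-unipotent i j = trans (border-diagonal i) (sym (border-diagonal j))

border-symmetric : {M : Square m} → IsSymmetric M → IsSymmetric (border M)
border-symmetric symM zero zero = refl
border-symmetric symM zero (suc j) = refl
border-symmetric symM (suc i) zero = refl
border-symmetric symM (suc i) (suc j) with i ≟ j | j ≟ i
... | yes _ | yes _ = refl
... | yes e | no ¬e = contradiction (sym e) ¬e
... | no ¬e | yes e = contradiction (sym e) ¬e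
... | no _ | no _ = cong suc (symM i j)

-- The new row is the old diagonal, so it has no repetition exactly when the diagonal has none.
border-latin : {M : Square m} → IsLatin M → IsSymmetric M → (∀ {i j} → M i i ≡ M j j → i ≡ j) →
  IsLatin (border M)
border-latin {M = M} (rows , _) symM diag = symmetric⇒latin (border-symmetric symM) border-rows
  where
  border-rows : ∀ r c c′ → border M r c ≡ border M r c′ → c ≡ c′
  border-rows zero zero zero eq = refl
  border-rows zero (suc j) (suc j′) eq = cong suc (diag (suc-injective eq))
  border-rows (suc i) zero zero eq = refl
  border-rows (suc i) zero (suc j) eq with i ≟ j
  ... | no i≢j = contradiction (rows i i j (suc-injective eq)) i≢j
  border-rows (suc i) (suc j) zero eq with i ≟ j
  ... | no i≢j = contradiction (rows i i j (sym (suc-injective eq))) i≢j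
  border-rows (suc i) (suc j) (suc j′) eq with i ≟ j | i ≟ j′
  ... | yes p | yes q = cong suc (trans (sym p) q)
  ... | no _ | no _ = cong suc (rows i j j′ (suc-injective eq))

border-cong : {M M′ : Square m} → SameSquare M M′ → SameSquare (border M) (border M′)
border-cong same zero zero = refl
border-cong same zero (suc j) = cong suc (same j j)
border-cong same (suc i) zero = cong suc (same i i)
border-cong same (suc i) (suc j) with i ≟ j
... | yes _ = refl
... | no _ = cong suc (same i j)

-- The overwritten diagonal entries survive in the new row.
border-injective : {M M′ : Square m} → SameSquare (border M) (border M′) → SameSquare M M′
border-injective {M = M} {M′} same i j with i ≟ j
... | yes refl = suc-injective (same zero (suc i))
... | no i≢j = suc-injective (trans (sym (border-interior M i≢j))
                 (trans (same (suc i) (suc j)) (border-interior M′ i≢j)))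

border-reduced : {M : Square m} → IsIdempotent M → IsReduced (border M)
border-reduced idem zero _ zero = refl , refl
border-reduced idem zero _ (suc i) = cong suc (idem i) , cong suc (idem i)

border-reduced⁻¹ : {M : Square m} → IsReduced (border M) → IsIdempotent M
border-reduced⁻¹ red i = suc-injective (proj₁ (red zero refl (suc i)))

module Unborder {L : Square (suc m)} (lat : IsLatin L) (symL : IsSymmetric L)
                (uni : IsUnipotent L) (L₀₀ : L zero zero ≡ zero) where

  -- The column of row `suc i` in which a bordered square keeps the entry `(i , j)` of its core;
  -- diagonal entries are kept in the border.
  cell : Fin m → Fin m → Fin (suc m)
  cell i j with i ≟ j
  ... | yes _ = zero
  ... | no _ = suc j

  cell-injective : ∀ {i j j′} → cell i j ≡ cell i j′ → j ≡ j′
  cell-injective {i} {j} {j′} eq with i ≟ j | i ≟ j′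
  ... | yes p | yes q = trans (sym p) q
  ... | no _ | no _ = suc-injective eq

  cell-diagonal : ∀ i → cell i i ≡ zero
  cell-diagonal i with i ≟ i
  ... | yes _ = refl
  ... | no i≢i = contradiction refl i≢i

  cell-interior : ∀ {i j} → i ≢ j → cell i j ≡ suc j
  cell-interior {i} {j} i≢j with i ≟ j
  ... | yes i≡j = contradiction i≡j i≢j
  ... | no _ = refl

  cell≢ : ∀ i j → cell i j ≢ suc i
  cell≢ i j with i ≟ j
  ... | yes _ = λ ()
  ... | no i≢j = λ eq → i≢j (sym (suc-injective eq))

  -- By unipotency `zero` fills the diagonal, so row `suc i` holds it in column `suc i` only, which
  -- `cell i j` avoids. Entries of the core can therefore be shifted down.
  0≢L-cell : ∀ i j → zero ≢ L (suc i) (cell i j)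
  0≢L-cell i j eq = cell≢ i j (proj₁ lat (suc i) _ _
    (trans (sym eq) (trans (sym L₀₀) (uni zero (suc i)))))

  core : Square m
  core i j = punchOut (0≢L-cell i j)

  suc-core : ∀ i j → suc (core i j) ≡ L (suc i) (cell i j)
  suc-core i j = punchIn-punchOut (0≢L-cell i j)

  suc-core-interior : ∀ {i j} → i ≢ j → suc (core i j) ≡ L (suc i) (suc j)
  suc-core-interior i≢j = trans (suc-core _ _) (cong (L _) (cell-interior i≢j))

  suc-core-diagonal : ∀ i → suc (core i i) ≡ L (suc i) zero
  suc-core-diagonal i = trans (suc-core i i) (cong (L _) (cell-diagonal i))

  core-symmetric : IsSymmetric core
  core-symmetric i j = case i ≟ j of λ
    { (yes refl) → refl
    ; (no i≢j) → suc-injective (trans (suc-core-interior i≢j)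
        (trans (symL _ _) (sym (suc-core-interior (i≢j ∘ sym))))) }

  core-latin : IsLatin core
  core-latin = symmetric⇒latin core-symmetric λ i j j′ eq → cell-injective (proj₁ lat (suc i) _ _
    (trans (sym (suc-core i j)) (trans (cong suc eq) (suc-core i j′))))

  border-core : SameSquare L (border core)
  border-core zero zero = L₀₀
  border-core zero (suc j) = trans (symL _ _) (sym (suc-core-diagonal j))
  border-core (suc i) zero = sym (suc-core-diagonal i)
  border-core (suc i) (suc j) = case i ≟ j of λ
    { (yes refl) → trans (uni (suc i) zero) (trans L₀₀ (sym (border-diagonal core (suc i))))
    ; (no i≢j) → trans (sym (suc-core-interior i≢j)) (sym (border-interior core i≢j)) }

-- Totally symmetric squares

-- Invariance of the set of triples under exchanging columns with symbols.
IsInvolutory : Square n → Set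
IsInvolutory L = ∀ r c → L r (L r c) ≡ c

totallySymmetric⇒ : IsTotallySymmetric L → IsSymmetric L × IsInvolutory L
totallySymmetric⇒ {L = L} ts =
    (λ r c → sym (ts (transpose zero (suc zero)) (triple r c (L r c)) refl))
  , (λ r c → ts (transpose (suc zero) (suc (suc zero))) (triple r c (L r c)) refl)

-- Two transpositions generate all permutations of the coordinates. The split is on the three values
-- of `δ`: six patterns are permutations, and the others contradict injectivity.
⇒totallySymmetric : IsSymmetric L → IsInvolutory L → IsTotallySymmetric L
⇒totallySymmetric {L = L} symL inv δ t t∈L = go (δ ⟨$⟩ʳ zero) (δ ⟨$⟩ʳ suc zero) (δ ⟨$⟩ʳ suc (suc zero))
    (distinct λ ()) (distinct λ ()) (distinct λ ())
  where
  distinct : ∀ {i j} → i ≢ j → δ ⟨$⟩ʳ i ≢ δ ⟨$⟩ʳ j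
  distinct i≢j = i≢j ∘ permutation-injective δ
  rs→c : L (t zero) (t (suc (suc zero))) ≡ t (suc zero)
  rs→c = trans (cong (L _) (sym t∈L)) (inv _ _)
  cs→r : L (t (suc zero)) (t (suc (suc zero))) ≡ t zero
  cs→r = trans (cong (L _) (trans (sym t∈L) (symL _ _))) (inv _ _)
  go : ∀ i j k → i ≢ j → i ≢ k → j ≢ k → L (t i) (t j) ≡ t k
  go zero (suc zero) (suc (suc zero)) _ _ _ = t∈L
  go zero (suc (suc zero)) (suc zero) _ _ _ = rs→c
  go (suc zero) zero (suc (suc zero)) _ _ _ = trans (symL _ _) t∈L
  go (suc zero) (suc (suc zero)) zero _ _ _ = cs→r
  go (suc (suc zero)) zero (suc zero) _ _ _ = trans (symL _ _) rs→c
  go (suc (suc zero)) (suc zero) zero _ _ _ = trans (symL _ _) cs→r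
  go zero zero _ p _ _ = contradiction refl p
  go (suc zero) (suc zero) _ p _ _ = contradiction refl p
  go (suc (suc zero)) (suc (suc zero)) _ p _ _ = contradiction refl p
  go zero (suc _) zero _ p _ = contradiction refl p
  go (suc zero) _ (suc zero) _ p _ = contradiction refl p
  go (suc (suc zero)) _ (suc (suc zero)) _ p _ = contradiction refl p
  go _ zero zero _ _ p = contradiction refl p
  go _ (suc zero) (suc zero) _ _ p = contradiction refl p
  go _ (suc (suc zero)) (suc (suc zero)) _ _ p = contradiction refl p

border-involutory : {M : Square m} → IsLatin M → IsIdempotent M → IsInvolutory M → IsInvolutory (border M)
border-involutory {M = M} lat idem inv zero zero = refl
border-involutory {M = M} lat idem inv zero (suc j) = cong suc (trans (idem (M j j)) (idem j))
border-involutory {M = M} lat idem inv (suc i) zero =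
  trans (cong (border M (suc i) ∘ suc) (idem i)) (border-diagonal M (suc i))
border-involutory {M = M} lat idem inv (suc i) (suc j) with i ≟ j
... | yes refl = cong suc (idem i)
-- Row `i` already holds `i` on the diagonal, so `M i j` is not `i` and the second application again
-- reads an interior cell.
... | no i≢j = trans (border-interior M (λ e → i≢j (proj₁ lat i i j (trans (idem i) e)))) (cong suc (inv i j))

border-involutory⁻¹ : {M : Square m} → IsLatin M → IsIdempotent M → IsInvolutory (border M) → IsInvolutory M
border-involutory⁻¹ {M = M} lat idem inv i j with i ≟ j
... | yes refl = trans (cong (M i) (idem i)) (idem i)
... | no i≢j = suc-injective (trans (sym (border-interior M (λ e → i≢j (proj₁ lat i i j (trans (idem i) e)))))
      (trans (cong (border M (suc i)) (sym (border-interior M i≢j))) (inv (suc i) (suc j))))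

-- Isotopisms: equivalence, decidability and finite class numbers

maps-sym : (α β γ : Permutation′ n) → IsotopismMaps α β γ L₁ L₂ →
  IsotopismMaps (flip α) (flip β) (flip γ) L₂ L₁
maps-sym {L₂ = L₂} α β γ h r c = sym (trans
  (cong (γ ⟨$⟩ˡ_) (trans (cong₂ L₂ (sym (inverseʳ α)) (sym (inverseʳ β))) (h _ _))) (inverseˡ γ))

maps-trans : (α β γ α′ β′ γ′ : Permutation′ n) → IsotopismMaps α β γ L₁ L₂ → IsotopismMaps α′ β′ γ′ L₂ L₃ →
  IsotopismMaps (α ∘ₚ α′) (β ∘ₚ β′) (γ ∘ₚ γ′) L₁ L₃
maps-trans α β γ α′ β′ γ′ h h′ r c = trans (h′ _ _) (cong (γ′ ⟨$⟩ʳ_) (h r c))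

maps-resp : (α β γ α′ β′ γ′ : Permutation′ n) → α ≈ α′ → β ≈ β′ → γ ≈ γ′ →
  IsotopismMaps α β γ L₁ L₂ → IsotopismMaps α′ β′ γ′ L₁ L₂
maps-resp {L₂ = L₂} α β γ α′ β′ γ′ α≈ β≈ γ≈ h r c =
  trans (cong₂ L₂ (sym (α≈ r)) (sym (β≈ c))) (trans (h r c) (γ≈ _))

maps? : (α β γ : Permutation′ n) (L₁ L₂ : Square n) → Dec (IsotopismMaps α β γ L₁ L₂)
maps? α β γ L₁ L₂ = all? λ r → all? λ c → _ ≟ _

isotopic? : (L₁ L₂ : Square n) → Dec (Isotopic L₁ L₂)
isotopic? L₁ L₂ = ∃-permutation?
  (λ α → ∃-permutation?
    (λ β → ∃-permutation? (λ γ → maps? α β γ L₁ L₂)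
      λ {γ} {γ′} e → maps-resp {L₂ = L₂} α β γ α β γ′ (λ _ → refl) (λ _ → refl) e)
    λ {β} {β′} e (γ , h) → γ , maps-resp {L₂ = L₂} α β γ α β′ γ (λ _ → refl) e (λ _ → refl) h)
  λ {α} {α′} e (β , γ , h) → β , γ , maps-resp {L₂ = L₂} α β γ α′ β γ e (λ _ → refl) (λ _ → refl) h

rrsIsotopic? : (L₁ L₂ : Square n) → Dec (RRSIsotopic L₁ L₂)
rrsIsotopic? L₁ L₂ = ∃-permutation?
  (λ α → ∃-permutation? (λ γ → maps? α α γ L₁ L₂)
    λ {γ} {γ′} e → maps-resp {L₂ = L₂} α α γ α α γ′ (λ _ → refl) (λ _ → refl) e)
  λ {α} {α′} e (γ , h) → γ , maps-resp {L₂ = L₂} α α γ α′ α′ γ e e (λ _ → refl) h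

isomorphic? : (L₁ L₂ : Square n) → Dec (Isomorphic L₁ L₂)
isomorphic? L₁ L₂ = ∃-permutation? (λ α → maps? α α α L₁ L₂)
  λ {α} {α′} e → maps-resp {L₂ = L₂} α α α α′ α′ α′ e e e

sameSquare? : (L₁ L₂ : Square n) → Dec (SameSquare L₁ L₂)
sameSquare? L₁ L₂ = all? λ r → all? λ c → L₁ r c ≟ L₂ r c

sameSquare-sym : SameSquare L₁ L₂ → SameSquare L₂ L₁
sameSquare-sym same r c = sym (same r c)

sameSquare-trans : SameSquare L₁ L₂ → SameSquare L₂ L₃ → SameSquare L₁ L₃
sameSquare-trans same same′ r c = trans (same r c) (same′ r c)

isotopic-sym : Isotopic L₁ L₂ → Isotopic L₂ L₁
isotopic-sym (α , β , γ , h) = flip α , flip β , flip γ , maps-sym α β γ h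

isotopic-trans : Isotopic L₁ L₂ → Isotopic L₂ L₃ → Isotopic L₁ L₃
isotopic-trans {L₃ = L₃} (α , β , γ , h) (α′ , β′ , γ′ , h′) =
  α ∘ₚ α′ , β ∘ₚ β′ , γ ∘ₚ γ′ , maps-trans {L₃ = L₃} α β γ α′ β′ γ′ h h′

rrs-sym : RRSIsotopic L₁ L₂ → RRSIsotopic L₂ L₁
rrs-sym (α , γ , h) = flip α , flip γ , maps-sym α α γ h

rrs-trans : RRSIsotopic L₁ L₂ → RRSIsotopic L₂ L₃ → RRSIsotopic L₁ L₃
rrs-trans {L₃ = L₃} (α , γ , h) (α′ , γ′ , h′) = α ∘ₚ α′ , γ ∘ₚ γ′ , maps-trans {L₃ = L₃} α α γ α′ α′ γ′ h h′

isomorphic-sym : Isomorphic L₁ L₂ → Isomorphic L₂ L₁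
isomorphic-sym (α , h) = flip α , maps-sym α α α h

isomorphic-trans : Isomorphic L₁ L₂ → Isomorphic L₂ L₃ → Isomorphic L₁ L₃
isomorphic-trans {L₃ = L₃} (α , h) (α′ , h′) = α ∘ₚ α′ , maps-trans {L₃ = L₃} α α α α′ α′ α′ h h′

rrs⇒isotopic : RRSIsotopic L₁ L₂ → Isotopic L₁ L₂
rrs⇒isotopic (α , γ , h) = α , α , γ , h

isotopic⇒paratopic : Isotopic L₁ L₂ → Paratopic L₁ L₂
isotopic⇒paratopic (α , β , γ , h) = Perm.id , α , β , γ , h

sameSquare⇒isomorphic : SameSquare L₁ L₂ → Isomorphic L₁ L₂
sameSquare⇒isomorphic same = Perm.id , λ r c → sym (same r c)

sameSquare⇒rrs : SameSquare L₁ L₂ → RRSIsotopic L₁ L₂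
sameSquare⇒rrs same = let (α , h) = sameSquare⇒isomorphic same in α , α , h

sameSquare⇒isotopic : SameSquare L₁ L₂ → Isotopic L₁ L₂
sameSquare⇒isotopic {L₂ = L₂} same = rrs⇒isotopic {L₂ = L₂} (sameSquare⇒rrs same)

latin? : (L : Square n) → Dec (IsLatin L)
latin? L = (all? λ r → all? λ c → all? λ c′ → (L r c ≟ L r c′) →-dec (c ≟ c′))
     ×-dec (all? λ r → all? λ r′ → all? λ c → (L r c ≟ L r′ c) →-dec (r ≟ r′))

symmetric? : (L : Square n) → Dec (IsSymmetric L)
symmetric? L = all? λ r → all? λ c → L r c ≟ L c r

unipotent? : (L : Square n) → Dec (IsUnipotent L)
unipotent? L = all? λ i → all? λ j → L i i ≟ L j j

idempotent? : (L : Square n) → Dec (IsIdempotent L)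
idempotent? L = all? λ i → L i i ≟ i

-- The definition ranges over triples, which are functions; the equivalent pair of conditions is a
-- finite check over cells.
totallySymmetric? : (L : Square n) → Dec (IsTotallySymmetric L)
totallySymmetric? L = map′ (λ (s , i) → ⇒totallySymmetric s i) totallySymmetric⇒
  (symmetric? L ×-dec all? λ r → all? λ c → L r (L r c) ≟ c)

latin-resp : SameSquare L₁ L₂ → IsLatin L₁ → IsLatin L₂
latin-resp same (rows , cols) =
    (λ r c c′ eq → rows r c c′ (trans (same r c) (trans eq (sym (same r c′)))))
  , (λ r r′ c eq → cols r r′ c (trans (same r c) (trans eq (sym (same r′ c)))))

symmetric-resp : SameSquare L₁ L₂ → IsSymmetric L₁ → IsSymmetric L₂
symmetric-resp same symL r c = trans (sym (same r c)) (trans (symL r c) (same c r))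

unipotent-resp : SameSquare L₁ L₂ → IsUnipotent L₁ → IsUnipotent L₂
unipotent-resp same uni i j = trans (sym (same i i)) (trans (uni i j) (same j j))

idempotent-resp : SameSquare L₁ L₂ → IsIdempotent L₁ → IsIdempotent L₂
idempotent-resp same idem i = trans (sym (same i i)) (idem i)

reduced-resp : SameSquare L₁ L₂ → IsReduced L₁ → IsReduced L₂
reduced-resp same red z z≡0 i =
  trans (sym (same z i)) (proj₁ (red z z≡0 i)) , trans (sym (same i z)) (proj₂ (red z z≡0 i))

totallySymmetric-resp : SameSquare L₁ L₂ → IsTotallySymmetric L₁ → IsTotallySymmetric L₂
totallySymmetric-resp same ts δ t t∈L = trans (sym (same _ _)) (ts δ t (trans (same _ _) t∈L))

count-squares : ∀ n → Count {Square n} Everything SameSquare ((n ^ n) ^ n)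
count-squares n = count-functions n (count-functions n (count-Fin n))

-- There are finitely many squares up to `SameSquare`, and the property and the relation are
-- decidable, so representatives can be selected greedily.
classes-exist : {P : Square n → Set} {R : Square n → Square n → Set} →
  (∀ L → Dec (P L)) → (∀ {L₁ L₂} → SameSquare L₁ L₂ → P L₁ → P L₂) →
  (∀ L₁ L₂ → Dec (R L₁ L₂)) → (∀ {L₁ L₂} → SameSquare L₁ L₂ → R L₁ L₂) →
  (∀ {L₁ L₂} → R L₁ L₂ → R L₂ L₁) → (∀ {L₁ L₂ L₃} → R L₁ L₂ → R L₂ L₃ → R L₁ L₃) →
  ∃ λ k → Count (λ L → IsLatin L × P L) R k
classes-exist P? P-resp R? same⇒R R-sym R-trans = count-exists
  (λ L → latin? L ×-dec P? L) R? (same⇒R λ _ _ → refl) R-sym (count-squares _)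
  (λ same (l , p) → latin-resp same l , P-resp same p) same⇒R R-trans

-- Species and isotopism classes

-- A symmetry of L₂ conjugates to an autoparatopism of L₁ exchanging rows and symbols;
-- with the symmetry of L₁ it yields one exchanging columns and symbols.
column-symbol-exchange : IsLatin L₂ → IsSymmetric L₁ → IsSymmetric L₂ → (α β γ : Permutation′ n) →
  (∀ r c → L₂ (α ⟨$⟩ʳ r) (γ ⟨$⟩ʳ L₁ r c) ≡ β ⟨$⟩ʳ c) → RRSIsotopic L₁ L₂
column-symbol-exchange {L₂ = L₂} {L₁ = L₁} lat₂ sym₁ sym₂ α β γ h = α , γ ∘ₚ flip α ∘ₚ β , λ r c → begin
  L₂ (α ⟨$⟩ʳ r) (α ⟨$⟩ʳ c)                  ≡⟨ cong (L₂ _) (trans (cong (γ ⟨$⟩ʳ_) (exchange r c)) (inverseʳ γ)) ⟨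
  L₂ (α ⟨$⟩ʳ r) (γ ⟨$⟩ʳ L₁ r (θ (L₁ r c)))  ≡⟨ h r (θ (L₁ r c)) ⟩
  β ⟨$⟩ʳ θ (L₁ r c)                         ∎
  where
  open ≡-Reasoning
  θ : Fin _ → Fin _
  θ s = α ⟨$⟩ˡ (γ ⟨$⟩ʳ s)
  pull : ∀ {r c s} → L₂ (α ⟨$⟩ʳ r) (γ ⟨$⟩ʳ s) ≡ β ⟨$⟩ʳ c → L₁ r c ≡ s
  pull {r} {c} eq = permutation-injective γ (proj₁ lat₂ _ _ _ (trans (h r c) (sym eq)))
  -- This is the autoparatopism of `L₁` taking (r, c, s) to (r, θs, γ⁻¹αc); composing it with `h`
  -- returns symbols to the symbol coordinate.
  exchange : ∀ r c → L₁ r (θ (L₁ r c)) ≡ γ ⟨$⟩ˡ (α ⟨$⟩ʳ c)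
  exchange r c = trans (sym₁ _ _) (pull (begin
    L₂ (α ⟨$⟩ʳ θ (L₁ r c)) (γ ⟨$⟩ʳ (γ ⟨$⟩ˡ (α ⟨$⟩ʳ c)))  ≡⟨ cong₂ L₂ (inverseʳ α) (inverseʳ γ) ⟩
    L₂ (γ ⟨$⟩ʳ L₁ r c) (α ⟨$⟩ʳ c)                        ≡⟨ sym₂ _ _ ⟩
    L₂ (α ⟨$⟩ʳ c) (γ ⟨$⟩ʳ L₁ r c)                        ≡⟨ cong (λ s → L₂ _ (γ ⟨$⟩ʳ s)) (sym₁ r c) ⟩
    L₂ (α ⟨$⟩ʳ c) (γ ⟨$⟩ʳ L₁ c r)                        ≡⟨ h c r ⟩
    β ⟨$⟩ʳ r                                             ∎))

-- If symbols stay symbols, the paratopism is an isotopism, possibly after transposing `L₂`.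
-- Otherwise the symmetries of `L₂` and `L₁` bring it to the form handled by
-- `column-symbol-exchange`.
paratopic⇒isotopic : IsLatin L₂ → IsSymmetric L₁ → IsSymmetric L₂ → Paratopic L₁ L₂ → Isotopic L₁ L₂
paratopic⇒isotopic {L₂ = L₂} {L₁ = L₁} lat₂ sym₁ sym₂ (δ , α , β , γ , h) =
  go (δ ⟨$⟩ʳ zero) (δ ⟨$⟩ʳ suc zero) (δ ⟨$⟩ʳ suc (suc zero)) h
    (distinct λ ()) (distinct λ ()) (distinct λ ())
  where
  distinct : ∀ {i j} → i ≢ j → δ ⟨$⟩ʳ i ≢ δ ⟨$⟩ʳ j
  distinct i≢j = i≢j ∘ permutation-injective δ
  image : Fin _ → Fin _ → Triple _
  image r c = triple (α ⟨$⟩ʳ r) (β ⟨$⟩ʳ c) (γ ⟨$⟩ʳ L₁ r c)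
  exchange : (α β : Permutation′ _) → (∀ r c → L₂ (α ⟨$⟩ʳ r) (γ ⟨$⟩ʳ L₁ r c) ≡ β ⟨$⟩ʳ c) → Isotopic L₁ L₂
  exchange α β = rrs⇒isotopic {L₂ = L₂} ∘ column-symbol-exchange lat₂ sym₁ sym₂ α β γ
  swap : ∀ {r c} → L₂ (β ⟨$⟩ʳ c) (γ ⟨$⟩ʳ L₁ r c) ≡ α ⟨$⟩ʳ r → L₂ (β ⟨$⟩ʳ c) (γ ⟨$⟩ʳ L₁ c r) ≡ α ⟨$⟩ʳ r
  swap {r} {c} = subst (λ s → L₂ _ (γ ⟨$⟩ʳ s) ≡ _) (sym₁ r c)
  go : ∀ i j k → (∀ r c → L₂ (image r c i) (image r c j) ≡ image r c k) →
    i ≢ j → i ≢ k → j ≢ k → Isotopic L₁ L₂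
  go zero (suc zero) (suc (suc zero)) h _ _ _ = α , β , γ , h
  go (suc zero) zero (suc (suc zero)) h _ _ _ = α , β , γ , λ r c → trans (sym₂ _ _) (h r c)
  go zero (suc (suc zero)) (suc zero) h _ _ _ = exchange α β h
  go (suc (suc zero)) zero (suc zero) h _ _ _ = exchange α β λ r c → trans (sym₂ _ _) (h r c)
  go (suc zero) (suc (suc zero)) zero h _ _ _ = exchange β α λ r c → swap (h c r)
  go (suc (suc zero)) (suc zero) zero h _ _ _ = exchange β α λ r c → swap (trans (sym₂ _ _) (h c r))
  go zero zero _ _ p _ _ = contradiction refl p
  go (suc zero) (suc zero) _ _ p _ _ = contradiction refl p
  go (suc (suc zero)) (suc (suc zero)) _ _ p _ _ = contradiction refl p
  go zero (suc _) zero _ _ p _ = contradiction refl p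
  go (suc zero) _ (suc zero) _ _ p _ = contradiction refl p
  go (suc (suc zero)) _ (suc (suc zero)) _ _ p _ = contradiction refl p
  go _ zero zero _ _ _ p = contradiction refl p
  go _ (suc zero) (suc zero) _ _ _ p = contradiction refl p
  go _ (suc (suc zero)) (suc (suc zero)) _ _ _ p = contradiction refl p

-- Isotopism and rrs-isotopism classes

-- Symmetry and unipotency determine the second row from the first, so matching first rows suffices.
-- Order two is separate because `order-bound` gives no contradiction there.
order-two-rrs : {L₁ L₂ : Square 2} → IsLatin L₁ → IsSymmetric L₁ → IsUnipotent L₁ →
  IsLatin L₂ → IsSymmetric L₂ → IsUnipotent L₂ → RRSIsotopic L₁ L₂
order-two-rrs {L₁} {L₂} lat₁ sym₁ uni₁ lat₂ sym₂ uni₂ = Perm.id , γ , maps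
  where
  γ : Permutation′ 2
  γ = flip (row lat₁ zero) ∘ₚ row lat₂ zero
  first-row : ∀ c → L₂ zero c ≡ γ ⟨$⟩ʳ L₁ zero c
  first-row c = cong (L₂ zero) (sym (inverseˡ (row lat₁ zero)))
  maps : IsotopismMaps Perm.id Perm.id γ L₁ L₂
  maps zero c = first-row c
  maps (suc zero) zero = trans (sym₂ _ _) (trans (first-row _) (cong (γ ⟨$⟩ʳ_) (sym₁ _ _)))
  maps (suc zero) (suc zero) = trans (uni₂ _ _) (trans (first-row _) (cong (γ ⟨$⟩ʳ_) (uni₁ zero (suc zero))))

module SelfAdjoint {L : Square (suc m)} (lat : IsLatin L) (symL : IsSymmetric L) (uni : IsUnipotent L)
  (θ : Fin (suc m) → Fin (suc m)) (adjoint : ∀ r c → L (θ r) c ≡ L r (θ c)) where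

  -- `L x (θ (θ x))` equals `L (θ x) (θ x)`, the diagonal symbol, which row `x` holds only in column
  -- `x`.
  θ-involutive : ∀ x → θ (θ x) ≡ x
  θ-involutive x = proj₁ lat x _ _ (trans (sym (adjoint x (θ x))) (uni _ _))

  -- Column `x` has equal entries in rows `θ y` and `y`.
  fixed-point⇒identity : ∀ {x} → θ x ≡ x → ∀ y → θ y ≡ y
  fixed-point⇒identity {x} fix y = proj₂ lat _ _ x (trans (adjoint y x) (cong (L y) fix))

  module _ (4∤ : ¬ 4 ∣ suc m) (free : ∀ x → θ x ≢ x) where

    -- Otherwise θ and the perfect matching of the cells holding s would generate a
    -- group of order four acting freely.
    symbol-on-θ : ∀ s → s ≢ L zero zero → ∃ λ x → L x (θ x) ≡ s
    symbol-on-θ s s≢d with any? (λ x → L x (θ x) ≟ s)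
    ... | yes hit = hit
    ... | no miss = contradiction
          (four-divides θ (λ x → column lat x s) θ-involutive free (column-involutive lat symL s)
            (λ x e → s≢d (trans (sym (L-column lat x s)) (trans (cong (L x) e) (uni x zero))))
            (λ x → column-unique lat (trans (adjoint x _) (trans (cong (L x) (θ-involutive _)) (L-column lat x s))))
            (λ x e → miss (x , trans (cong (L x) (sym e)) (L-column lat x s))))
          4∤

    point : Fin m → Fin (suc m)
    point s = proj₁ (symbol-on-θ (punchIn (L zero zero) s) (punchInᵢ≢i _ s))

    point-spec : ∀ s → L (point s) (θ (point s)) ≡ punchIn (L zero zero) s
    point-spec s = proj₂ (symbol-on-θ (punchIn (L zero zero) s) (punchInᵢ≢i _ s))

    symbol-on-θ-injective : ∀ {s s′ x} →
      L x (θ x) ≡ punchIn (L zero zero) s → L x (θ x) ≡ punchIn (L zero zero) s′ → s ≡ s′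
    symbol-on-θ-injective {s} {s′} e e′ = punchIn-injective (L zero zero) s s′ (trans (sym e) e′)

    θ-point-spec : ∀ s → L (θ (point s)) (θ (θ (point s))) ≡ punchIn (L zero zero) s
    θ-point-spec s = trans (cong (L _) (θ-involutive _)) (trans (symL _ _) (point-spec s))

    both : Fin m ⊎ Fin m → Fin (suc m)
    both (inj₁ s) = point s
    both (inj₂ s) = θ (point s)

    -- The cell `(x , θ x)` and its transpose carry the same symbol, so `s` can be recovered from
    -- either point; the two points differ because `θ` is free.
    both-injective : ∀ {x y} → both x ≡ both y → x ≡ y
    both-injective {inj₁ s} {inj₁ s′} eq = cong inj₁ (symbol-on-θ-injective (point-spec s)
      (subst (λ x → L x (θ x) ≡ _) (sym eq) (point-spec s′)))
    both-injective {inj₂ s} {inj₂ s′} eq = cong inj₂ (symbol-on-θ-injective (θ-point-spec s)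
      (subst (λ x → L x (θ x) ≡ _) (sym eq) (θ-point-spec s′)))
    both-injective {inj₁ s} {inj₂ s′} eq
      with symbol-on-θ-injective (point-spec s) (subst (λ x → L x (θ x) ≡ _) (sym eq) (θ-point-spec s′))
    ... | refl = contradiction (sym eq) (free _)
    both-injective {inj₂ s} {inj₁ s′} eq
      with symbol-on-θ-injective (θ-point-spec s) (subst (λ x → L x (θ x) ≡ _) (sym eq) (point-spec s′))
    ... | refl = contradiction eq (free _)

    -- Each of the `m` symbols off the diagonal claims two of the `suc m` points.
    order-bound : m + m ≤ suc m
    order-bound = injective⇒≤ {f = both ∘ splitAt m} λ {i} {j} eq →
      trans (sym (join-splitAt m m i))
        (trans (cong (join m m) (both-injective {splitAt m i} {splitAt m j} eq)) (join-splitAt m m j))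

isotopic⇒rrs : ∀ {n} → n % 4 ≡ 2 → {L₁ L₂ : Square n} →
  IsLatin L₁ → IsSymmetric L₁ → IsUnipotent L₁ → IsLatin L₂ → IsSymmetric L₂ → IsUnipotent L₂ →
  Isotopic L₁ L₂ → RRSIsotopic L₁ L₂
isotopic⇒rrs {2} _ lat₁ sym₁ uni₁ lat₂ sym₂ uni₂ _ = order-two-rrs lat₁ sym₁ uni₁ lat₂ sym₂ uni₂
isotopic⇒rrs {suc (suc (suc m))} n%4≡2 {L₁} {L₂} lat₁ sym₁ uni₁ lat₂ sym₂ uni₂ (α , β , γ , h)
  with all? (λ x → β ⟨$⟩ʳ x ≟ α ⟨$⟩ʳ x)
... | yes same = α , γ , maps-resp {L₂ = L₂} α β γ α α γ (λ _ → refl) same (λ _ → refl) h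
-- In order m + 3 the bound reads 2(m + 2) ≤ m + 3, which is false.
... | no ¬same = contradiction (order-bound 4∤ free) (λ { (s≤s (s≤s le)) → 1+n≰n (≤-trans (m≤n+m _ m) le) })
  where
  open ≡-Reasoning
  θ : Fin _ → Fin _
  θ x = α ⟨$⟩ˡ (β ⟨$⟩ʳ x)
  αθ : ∀ x → α ⟨$⟩ʳ θ x ≡ β ⟨$⟩ʳ x
  αθ x = inverseʳ α
  adjoint : ∀ r c → L₁ (θ r) c ≡ L₁ r (θ c)
  adjoint r c = permutation-injective γ (begin
    γ ⟨$⟩ʳ L₁ (θ r) c              ≡⟨ h (θ r) c ⟨
    L₂ (α ⟨$⟩ʳ θ r) (β ⟨$⟩ʳ c)     ≡⟨ cong₂ L₂ (αθ r) (sym (αθ c)) ⟩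
    L₂ (β ⟨$⟩ʳ r) (α ⟨$⟩ʳ θ c)     ≡⟨ sym₂ _ _ ⟩
    L₂ (α ⟨$⟩ʳ θ c) (β ⟨$⟩ʳ r)     ≡⟨ h (θ c) r ⟩
    γ ⟨$⟩ʳ L₁ (θ c) r              ≡⟨ cong (γ ⟨$⟩ʳ_) (sym₁ _ _) ⟩
    γ ⟨$⟩ʳ L₁ r (θ c)              ∎)
  open SelfAdjoint lat₁ sym₁ uni₁ θ adjoint
  free : ∀ x → θ x ≢ x
  free x fix = ¬same λ y → trans (sym (αθ y)) (cong (α ⟨$⟩ʳ_) (fixed-point⇒identity fix y))
  4∤ : ¬ 4 ∣ suc (suc (suc m))
  4∤ 4∣ with trans (sym n%4≡2) (n∣m⇒m%n≡0 _ 4 4∣)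
  ... | ()

-- One-factorisations

isomorphicOF-trans : {F₁ F₂ F₃ : List (Fin n → Fin n)} →
  IsomorphicOF F₁ F₂ → IsomorphicOF F₂ F₃ → IsomorphicOF F₁ F₃
isomorphicOF-trans (φ , to , from) (φ′ , to′ , from′) = φ ∘ₚ φ′
  , (λ i → let (j , h) = to i ; (k , h′) = to′ j in k , λ x → trans (cong (φ′ ⟨$⟩ʳ_) (h _)) (h′ x))
  , (λ k → let (j , h′) = from′ k ; (i , h) = from j in i , λ x → trans (cong (φ′ ⟨$⟩ʳ_) (h _)) (h′ x))

module Factors {L : Square (suc m)} (lat : IsLatin L) (symL : IsSymmetric L) (uni : IsUnipotent L) where

  -- Enumerates the symbols other than the diagonal one.
  symbol : Fin m → Fin (suc m)
  symbol = punchIn (L zero zero)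

  symbol⁻¹ : ∀ {t} → t ≢ L zero zero → ∃ λ s → symbol s ≡ t
  symbol⁻¹ t≢d = punchOut (t≢d ∘ sym) , punchIn-punchOut (t≢d ∘ sym)

  off-diagonal : ∀ {u v} → u ≢ v → L u v ≢ L zero zero
  off-diagonal {u} u≢v eq = u≢v (proj₁ lat u _ _ (trans (uni u zero) (sym eq)))

  factor : Fin m → Fin (suc m) → Fin (suc m)
  factor s u = column lat u (symbol s)

  L-factor : ∀ s u → L u (factor s u) ≡ symbol s
  L-factor s u = L-column lat u (symbol s)

  factor-matching : ∀ s → IsPerfectMatching (factor s)
  factor-matching s = column-involutive lat symL (symbol s)
    , λ u e → punchInᵢ≢i _ s (trans (sym (L-factor s u)) (trans (cong (L u) e) (uni u zero)))

  factors : List (Fin (suc m) → Fin (suc m))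
  factors = tabulate factor

  factors-oneFactorisation : IsOneFactorisation factors
  factors-oneFactorisation =
      (λ i → subst IsPerfectMatching (sym (lookup-tabulate′ factor i)) (factor-matching _))
    , (λ u v u≢v → let (s , e) = symbol⁻¹ (off-diagonal u≢v) in
        tabulate-index⁻¹ factor s
        , trans (cong (λ f → f u) (lookup-tabulate factor s)) (column-unique lat (sym e)))
    , (λ u v i j ei ej → tabulate-index-injective factor (punchIn-injective (L zero zero) _ _
        (trans (sym (at i ei)) (at j ej))))
    where
    at : ∀ {u v} i → lookup factors i u ≡ v → L u v ≡ symbol (tabulate-index factor i)
    at {u} i refl = trans (cong (λ f → L u (f u)) (lookup-tabulate′ factor i)) (L-factor _ u)

module _ {L₁ L₂ : Square (suc m)}
         (lat₁ : IsLatin L₁) (sym₁ : IsSymmetric L₁) (uni₁ : IsUnipotent L₁)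
         (lat₂ : IsLatin L₂) (sym₂ : IsSymmetric L₂) (uni₂ : IsUnipotent L₂) where

  private
    module F₁ = Factors lat₁ sym₁ uni₁
    module F₂ = Factors lat₂ sym₂ uni₂

  -- `γ` matches the two diagonal symbols, hence also the remaining symbols, and `α` carries the
  -- factor of a symbol to the factor of its image.
  rrs⇒isomorphicOF : RRSIsotopic L₁ L₂ → IsomorphicOF F₁.factors F₂.factors
  rrs⇒isomorphicOF (α , γ , h) = α
    , (λ i → let s = tabulate-index F₁.factor i
                 (t , e) = F₂.symbol⁻¹ λ e → punchInᵢ≢i _ s (permutation-injective γ (trans e diagonal))
             in tabulate-index⁻¹ F₂.factor t
              , λ x → trans (cong (λ f → mapMatching α f x) (lookup-tabulate′ F₁.factor i))
                     (trans (maps s t (sym e) x) (sym (cong (λ f → f x) (lookup-tabulate F₂.factor t)))))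
    , (λ j → let t = tabulate-index F₂.factor j
                 (s , e) = F₁.symbol⁻¹ λ e → punchInᵢ≢i _ t
                             (trans (sym (inverseʳ γ)) (trans (cong (γ ⟨$⟩ʳ_) e) (sym diagonal)))
             in tabulate-index⁻¹ F₁.factor s
              , λ x → trans (cong (λ f → mapMatching α f x) (lookup-tabulate F₁.factor s))
                     (trans (maps s t (trans (cong (γ ⟨$⟩ʳ_) e) (inverseʳ γ)) x)
                            (sym (cong (λ f → f x) (lookup-tabulate′ F₂.factor j)))))
    where
    diagonal : L₂ zero zero ≡ γ ⟨$⟩ʳ L₁ zero zero
    diagonal = trans (uni₂ zero (α ⟨$⟩ʳ zero)) (h zero zero)
    maps : ∀ s t → γ ⟨$⟩ʳ F₁.symbol s ≡ F₂.symbol t → ∀ x → mapMatching α (F₁.factor s) x ≡ F₂.factor t x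
    maps s t e x = sym (column-unique lat₂ (trans
      (cong (λ y → L₂ y (mapMatching α (F₁.factor s) x)) (sym (inverseʳ α)))
      (trans (h _ _) (trans (cong (γ ⟨$⟩ʳ_) (F₁.L-factor s _)) e))))

  -- Since `φ` sends each factor into a single factor, the symbol of `L₂` at the image of an
  -- off-diagonal cell depends only on the symbol of `L₁` in that cell. This dependence can be read
  -- off row `zero`, which defines `γ`.
  isomorphicOF⇒rrs : IsomorphicOF F₁.factors F₂.factors → RRSIsotopic L₁ L₂
  isomorphicOF⇒rrs (φ , to , _) = φ , γ , λ r c → case r ≟ c of λ
    { (yes refl) → trans (uni₂ _ _) (trans (γ-row zero) (cong (γ ⟨$⟩ʳ_) (uni₁ zero r)))
    ; (no r≢c) → let (s , e) = F₁.symbol⁻¹ (F₁.off-diagonal r≢c)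
                     (t , h) = image s
                 in trans (trans (cong (λ y → L₂ (φ ⟨$⟩ʳ r) (φ ⟨$⟩ʳ y)) (sym (column-unique lat₁ (sym e)))) (h r))
                   (trans (sym (h zero)) (trans (γ-row _) (cong (γ ⟨$⟩ʳ_) (trans (F₁.L-factor s zero) e)))) }
    where
    γ : Permutation′ (suc m)
    γ = flip (row lat₁ zero) ∘ₚ φ ∘ₚ row lat₂ (φ ⟨$⟩ʳ zero)
    γ-row : ∀ c → L₂ (φ ⟨$⟩ʳ zero) (φ ⟨$⟩ʳ c) ≡ γ ⟨$⟩ʳ L₁ zero c
    γ-row c = cong (λ y → L₂ (φ ⟨$⟩ʳ zero) (φ ⟨$⟩ʳ y)) (sym (inverseˡ (row lat₁ zero)))
    image : ∀ s → ∃ λ t → ∀ x → L₂ (φ ⟨$⟩ʳ x) (φ ⟨$⟩ʳ F₁.factor s x) ≡ F₂.symbol t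
    image s = let (j , h) = to (tabulate-index⁻¹ F₁.factor s) in
      tabulate-index F₂.factor j , λ x → trans
        (cong (L₂ (φ ⟨$⟩ʳ x)) (trans
          (cong₂ (λ f y → φ ⟨$⟩ʳ f y) (sym (lookup-tabulate F₁.factor s)) (sym (inverseˡ φ)))
          (trans (h (φ ⟨$⟩ʳ x)) (cong (λ f → f (φ ⟨$⟩ʳ x)) (lookup-tabulate′ F₂.factor j)))))
        (F₂.L-factor _ (φ ⟨$⟩ʳ x))

module FactorisationSquare (F : List (Fin (suc m) → Fin (suc m))) (isOF : IsOneFactorisation F) where

  private
    matching = proj₁ isOF
    covers = proj₁ (proj₂ isOF)
    unique = proj₂ (proj₂ isOF)

  0≢match : ∀ i → zero ≢ lookup F i zero
  0≢match i e = proj₂ (matching i) zero (sym e)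

  -- The factors are numbered by the partner of the vertex zero.
  number : Permutation (length F) m
  number = permutation
    (λ i → punchOut (0≢match i))
    (λ s → proj₁ (covers zero (suc s) λ ()))
    (λ s → suc-injective (trans (punchIn-punchOut (0≢match _)) (proj₂ (covers zero (suc s) λ ()))))
    (λ i → unique zero _ _ i (proj₂ (covers zero (suc (punchOut (0≢match i))) λ ()))
             (sym (punchIn-punchOut (0≢match i))))

  number-injective : ∀ {i j} → number ⟨$⟩ʳ i ≡ number ⟨$⟩ʳ j → i ≡ j
  number-injective e = trans (sym (inverseˡ number)) (trans (cong (number ⟨$⟩ˡ_) e) (inverseˡ number))

  square : Square (suc m)
  square u v with u ≟ v
  ... | yes _ = zero
  ... | no u≢v = suc (number ⟨$⟩ʳ proj₁ (covers u v u≢v))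

  square-diagonal : ∀ u → square u u ≡ zero
  square-diagonal u with u ≟ u
  ... | yes _ = refl
  ... | no u≢u = contradiction refl u≢u

  square-match : ∀ i u → square u (lookup F i u) ≡ suc (number ⟨$⟩ʳ i)
  square-match i u with u ≟ lookup F i u
  ... | yes e = contradiction (sym e) (proj₂ (matching i) u)
  ... | no u≢v = cong (λ j → suc (number ⟨$⟩ʳ j)) (unique u _ _ i (proj₂ (covers u _ u≢v)) refl)

  square-symmetric : IsSymmetric square
  square-symmetric u v = case u ≟ v of λ
    { (yes refl) → refl
    ; (no u≢v) → let (i , e) = covers u v u≢v in begin
        square u v                    ≡⟨ cong (square u) e ⟨
        square u (lookup F i u)       ≡⟨ square-match i u ⟩
        suc (number ⟨$⟩ʳ i)           ≡⟨ square-match i v ⟨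
        square v (lookup F i v)       ≡⟨ cong (square v ∘ lookup F i) e ⟨
        square v (lookup F i (lookup F i u)) ≡⟨ cong (square v) (proj₁ (matching i) u) ⟩
        square v u                    ∎ }
    where open ≡-Reasoning

  square-latin : IsLatin square
  square-latin = symmetric⇒latin square-symmetric rows
    where
    rows : ∀ u v v′ → square u v ≡ square u v′ → v ≡ v′
    rows u v v′ eq with u ≟ v | u ≟ v′
    ... | yes p | yes q = trans (sym p) q
    ... | no p | no q = trans (sym (proj₂ (covers u v p)))
          (trans (cong (λ i → lookup F i u) (number-injective (suc-injective eq))) (proj₂ (covers u v′ q)))

  square-unipotent : IsUnipotent square
  square-unipotent u v = trans (square-diagonal u) (sym (square-diagonal v))

  open Factors square-latin square-symmetric square-unipotent

  -- Both lists hold the same matchings in an order changed by `number`, so the identity on vertices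
  -- serves.
  factors-square : IsomorphicOF F factors
  factors-square = Perm.id
    , (λ i → tabulate-index⁻¹ factor (number ⟨$⟩ʳ i) , λ x →
        sym (trans (cong (λ f → f x) (lookup-tabulate factor _)) (column-unique square-latin (square-match i x))))
    , (λ j → number ⟨$⟩ˡ tabulate-index factor j , λ x →
        sym (trans (cong (λ f → f x) (lookup-tabulate′ factor j)) (column-unique square-latin
          (trans (square-match _ x) (cong suc (inverseʳ number))))))

-- Isomorphism classes

border-isomorphic : {M₁ M₂ : Square m} → Isomorphic M₁ M₂ → Isomorphic (border M₁) (border M₂)
border-isomorphic {m} {M₁} {M₂} (α , h) = lift₀ α , maps
  where
  maps : IsotopismMaps (lift₀ α) (lift₀ α) (lift₀ α) (border M₁) (border M₂)
  maps zero zero = refl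
  maps zero (suc j) = cong suc (h j j)
  maps (suc i) zero = cong suc (h i i)
  maps (suc i) (suc j) = case i ≟ j of λ
    { (yes refl) → trans (border-diagonal M₂ (suc (α ⟨$⟩ʳ i))) (cong (lift₀ α ⟨$⟩ʳ_) (sym (border-diagonal M₁ (suc i))))
    ; (no i≢j) → trans (border-interior M₂ (i≢j ∘ permutation-injective α))
        (trans (cong suc (h i j)) (cong (lift₀ α ⟨$⟩ʳ_) (sym (border-interior M₁ i≢j)))) }

-- An isomorphism sends diagonal symbol to diagonal symbol, so `α` fixes `zero` and restricts to the
-- remaining indices.
border-isomorphic⁻¹ : {M₁ M₂ : Square m} → Isomorphic (border M₁) (border M₂) → Isomorphic M₁ M₂
border-isomorphic⁻¹ {m} {M₁} {M₂} (α , h) = α′ , λ i j → case i ≟ j of λ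
    { (yes refl) → suc-injective (h′ zero (suc i))
    ; (no i≢j) → suc-injective (trans (sym (border-interior M₂ (i≢j ∘ permutation-injective α′)))
        (trans (h′ (suc i) (suc j)) (cong (lift₀ α′ ⟨$⟩ʳ_) (border-interior M₁ i≢j)))) }
  where
  α′ : Permutation′ m
  α′ = remove zero α
  α-zero : α ⟨$⟩ʳ zero ≡ zero
  α-zero = trans (sym (h zero zero)) (border-diagonal M₂ (α ⟨$⟩ʳ zero))
  h′ : IsotopismMaps (lift₀ α′) (lift₀ α′) (lift₀ α′) (border M₁) (border M₂)
  h′ = maps-resp {L₂ = border M₂} α α α (lift₀ α′) (lift₀ α′) (lift₀ α′) α≈ α≈ α≈ h
    where
    α≈ : α ≈ lift₀ α′
    α≈ i = sym (lift₀-remove α α-zero i)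

transport : Permutation′ n → Square n → Square n
transport α L r c = α ⟨$⟩ʳ L (α ⟨$⟩ˡ r) (α ⟨$⟩ˡ c)

transport-isomorphic : (α : Permutation′ n) (L : Square n) → Isomorphic L (transport α L)
transport-isomorphic α L = α , λ r c → cong (α ⟨$⟩ʳ_) (cong₂ L (inverseˡ α) (inverseˡ α))

transport-latin : (α : Permutation′ n) → IsLatin L → IsLatin (transport α L)
transport-latin α (rows , cols) =
    (λ r c c′ eq → permutation-injective (flip α) (rows _ _ _ (permutation-injective α eq)))
  , (λ r r′ c eq → permutation-injective (flip α) (cols _ _ _ (permutation-injective α eq)))

transpose-first : (i j : Fin n) → transpose i j ⟨$⟩ʳ i ≡ j
transpose-first i j rewrite dec-true (i ≟ i) refl = refl

-- Moving the diagonal symbol to zero makes a square a bordered one.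
isomorphic-to-border : {L : Square (suc m)} → IsLatin L → IsSymmetric L → IsUnipotent L →
  ∃ λ M → IsLatin M × IsSymmetric M × Isomorphic L (border M)
isomorphic-to-border {L = L} lat symL uni = U.core , U.core-latin , U.core-symmetric ,
  isomorphic-trans {L₃ = border U.core} (transport-isomorphic α L) (sameSquare⇒isomorphic U.border-core)
  where
  α : Permutation′ _
  α = transpose (L zero zero) zero
  module U = Unborder {L = transport α L} (transport-latin α lat)
    (λ r c → cong (α ⟨$⟩ʳ_) (symL _ _)) (λ i j → cong (α ⟨$⟩ʳ_) (uni _ _))
    (trans (cong (α ⟨$⟩ʳ_) (uni _ zero)) (transpose-first (L zero zero) zero))

-- Bijections between the counted families

idempotent⇒diagonal-injective : IsIdempotent L → ∀ {i j} → L i i ≡ L j j → i ≡ j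
idempotent⇒diagonal-injective idem {i} {j} e = trans (sym (idem i)) (trans e (idem j))

SymmetricUnipotent : Square n → Set
SymmetricUnipotent L = IsLatin L × IsSymmetric L × IsUnipotent L

idempotent≃unipotent-reduced : ∀ {m k} →
  Count (λ M → IsLatin M × (IsSymmetric ∧ IsIdempotent) M) SameSquare k →
  Count (λ L → IsLatin L × (IsSymmetric ∧ IsUnipotent ∧ IsReduced) L) (SameSquare {suc m}) k
idempotent≃unipotent-reduced = count-transfer
  (λ M _ → border M)
  (λ M (lat , symM , idem) →
    border-latin lat symM (idempotent⇒diagonal-injective {L = M} idem)
    , border-symmetric symM , border-unipotent M , border-reduced idem)
  (λ _ _ → border-injective)
  (λ L (lat , symL , uni , red) →
    let open Unborder lat symL uni (proj₁ (red zero refl zero)) in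
    core , (core-latin , core-symmetric , border-reduced⁻¹ (reduced-resp border-core red))
    , λ M _ same → sameSquare-trans border-core (border-cong same))

totallySymmetric-idempotent≃unipotent-reduced : ∀ {m k} →
  Count (λ M → IsLatin M × (IsTotallySymmetric ∧ IsIdempotent) M) SameSquare k →
  Count (λ L → IsLatin L × (IsTotallySymmetric ∧ IsUnipotent ∧ IsReduced) L) (SameSquare {suc m}) k
totallySymmetric-idempotent≃unipotent-reduced = count-transfer
  (λ M _ → border M)
  (λ M (lat , ts , idem) → let (symM , inv) = totallySymmetric⇒ ts in
    border-latin lat symM (idempotent⇒diagonal-injective {L = M} idem)
    , ⇒totallySymmetric (border-symmetric symM) (border-involutory lat idem inv)
    , border-unipotent M , border-reduced idem)
  (λ _ _ → border-injective)
  (λ L (lat , ts , uni , red) →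
    let open Unborder lat (proj₁ (totallySymmetric⇒ ts)) uni (proj₁ (red zero refl zero))
        idem = border-reduced⁻¹ (reduced-resp border-core red)
        inv = proj₂ (totallySymmetric⇒ {L = border core} (totallySymmetric-resp border-core ts))
    in core
    , (core-latin , ⇒totallySymmetric core-symmetric (border-involutory⁻¹ core-latin idem inv) , idem)
    , λ M _ same → sameSquare-trans border-core (border-cong same))

symmetric≃symmetricUnipotent : ∀ {m k} → ¬ 2 ∣ m →
  Count (λ M → IsLatin M × IsSymmetric M) (Isomorphic {m}) k →
  Count SymmetricUnipotent (Isomorphic {suc m}) k
symmetric≃symmetricUnipotent odd = count-transfer
  (λ M _ → border M)
  (λ M (lat , symM) → border-latin lat symM (diagonal-injective lat symM odd) , border-symmetric symM , border-unipotent M)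
  (λ {M} {M′} _ _ → border-isomorphic⁻¹ {M₁ = M} {M′})
  (λ L (lat , symL , uni) →
    let (M , latM , symM , iso) = isomorphic-to-border lat symL uni in
    M , (latM , symM) , λ M′ _ iso′ → isomorphic-trans {L₃ = border M′} iso (border-isomorphic iso′))

-- In odd order the diagonal of a symmetric square is a permutation, so a relabelling of symbols can
-- make either the first row or the diagonal the identity.
idempotent≃reduced : ∀ {m k} → ¬ 2 ∣ suc m →
  Count (λ M → IsLatin M × (IsSymmetric ∧ IsIdempotent) M) SameSquare k →
  Count (λ M → IsLatin M × (IsSymmetric ∧ IsReduced) M) (SameSquare {suc m}) k
idempotent≃reduced {m} odd = count-transfer
  (λ M (lat , _) → normalise lat)
  (λ M (lat , symM , _) → normalise-latin lat , normalise-symmetric lat symM , normalise-reduced lat symM)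
  (λ {M} {M′} (lat , _ , idem) (lat′ , _ , idem′) same →
    relabel-injective (flip (row lat zero)) (flip (row lat′ zero))
      -- The diagonal of a relabelled idempotent square is the relabelling itself, so equal results
      -- come from equal relabellings.
      (λ i → trans (cong (column lat zero) (sym (idem i))) (trans (same i i) (cong (column lat′ zero) (idem′ i))))
      same)
  (λ M (lat , symM , red) →
    let δ = injective⇒permutation (λ i → M i i) (diagonal-injective lat symM odd) in
    relabel (flip δ) M
    , (relabel-latin (flip δ) lat , relabel-symmetric (flip δ) symM , λ i → inverseˡ δ)
    , λ M′ (lat′ , _) same r c → sym (column-unique lat′ (trans (sym (same zero (M r c)))
        (trans (cong (δ ⟨$⟩ˡ_) (proj₁ (red zero refl (M r c)))) (same r c)))))

-- Each such square is a relabelling of a unique reduced one, and the relabelling is its first row.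
count-symmetricUnipotent : ∀ {m k} →
  Count (λ L → IsLatin L × (IsSymmetric ∧ IsUnipotent ∧ IsReduced) L) SameSquare k →
  Count SymmetricUnipotent (SameSquare {suc m}) ((suc m !) * k)
count-symmetricUnipotent {m} c = count-transfer {R = λ (γ , U) (γ′ , U′) → γ ≈ γ′ × SameSquare U U′}
  (λ (γ , U) _ → relabel γ U)
  (λ (γ , U) (_ , lat , symU , uni , _) →
    relabel-latin γ lat , relabel-symmetric γ symU , relabel-unipotent {L = U} γ uni)
  (λ { {γ , U} {γ′ , U′} (_ , _ , _ , _ , red) (_ , _ , _ , _ , red′) same →
      let γ≈γ′ = λ i → trans (cong (γ ⟨$⟩ʳ_) (sym (proj₁ (red zero refl i))))
                   (trans (same zero i) (cong (γ′ ⟨$⟩ʳ_) (proj₁ (red′ zero refl i))))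
      in γ≈γ′ , relabel-injective γ γ′ γ≈γ′ same })
  (λ L (lat , symL , uni) →
    (row lat zero , normalise lat)
    , (tt , normalise-latin lat , normalise-symmetric lat symL , normalise-unipotent lat uni , normalise-reduced lat symL)
    , λ { (γ , U) _ (γ≈ , same) r c → trans (sym (inverseʳ (row lat zero)))
          (trans (γ≈ _) (cong (γ ⟨$⟩ʳ_) (same r c))) })
  (count-× (count-permutations (suc m)) c)

rrs≃oneFactorisations : ∀ {m k} → Count SymmetricUnipotent (RRSIsotopic {suc m}) k →
  Count (IsOneFactorisation {suc m}) IsomorphicOF k
rrs≃oneFactorisations = count-transfer
  (λ L (lat , symL , uni) → Factors.factors lat symL uni)
  (λ L (lat , symL , uni) → Factors.factors-oneFactorisation lat symL uni)
  (λ (lat , symL , uni) (lat′ , symL′ , uni′) → isomorphicOF⇒rrs lat symL uni lat′ symL′ uni′)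
  (λ F isOF → let open FactorisationSquare F isOF in
    square , (square-latin , square-symmetric , square-unipotent)
    , λ L (lat , symL , uni) rrs → isomorphicOF-trans
        {F₁ = F} {Factors.factors square-latin square-symmetric square-unipotent} {Factors.factors lat symL uni}
        factors-square
        (rrs⇒isomorphicOF square-latin square-symmetric square-unipotent lat symL uni rrs))

-- Existence of the particular class numbers

isotopismClasses : ∀ n → ∃ (Count SymmetricUnipotent (Isotopic {n}))
isotopismClasses n = classes-exist {P = IsSymmetric ∧ IsUnipotent}
  (λ L → symmetric? L ×-dec unipotent? L)
  (λ same (s , u) → symmetric-resp same s , unipotent-resp same u)
  isotopic? (λ {_} {L₂} → sameSquare⇒isotopic {L₂ = L₂})
  (λ {L₁} {L₂} → isotopic-sym {L₁ = L₁} {L₂}) (λ {L₁} {L₂} {L₃} → isotopic-trans {L₁ = L₁} {L₂} {L₃})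

rrsIsotopismClasses : ∀ n → ∃ (Count SymmetricUnipotent (RRSIsotopic {n}))
rrsIsotopismClasses n = classes-exist {P = IsSymmetric ∧ IsUnipotent}
  (λ L → symmetric? L ×-dec unipotent? L)
  (λ same (s , u) → symmetric-resp same s , unipotent-resp same u)
  rrsIsotopic? (λ {_} {L₂} → sameSquare⇒rrs {L₂ = L₂})
  (λ {L₁} {L₂} → rrs-sym {L₁ = L₁} {L₂}) (λ {L₁} {L₂} {L₃} → rrs-trans {L₁ = L₁} {L₂} {L₃})

isomorphismClasses : ∀ n → ∃ (Count (λ L → IsLatin L × IsSymmetric L) (Isomorphic {n}))
isomorphismClasses n = classes-exist {P = IsSymmetric} symmetric? symmetric-resp
  isomorphic? (λ {_} {L₂} → sameSquare⇒isomorphic {L₂ = L₂})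
  (λ {L₁} {L₂} → isomorphic-sym {L₁ = L₁} {L₂}) (λ {L₁} {L₂} {L₃} → isomorphic-trans {L₁ = L₁} {L₂} {L₃})

symmetricIdempotents : ∀ n → ∃ (Count (λ L → IsLatin L × (IsSymmetric ∧ IsIdempotent) L) (SameSquare {n}))
symmetricIdempotents n = classes-exist {P = IsSymmetric ∧ IsIdempotent}
  (λ L → symmetric? L ×-dec idempotent? L)
  (λ same (s , i) → symmetric-resp same s , idempotent-resp same i)
  sameSquare? (λ same → same) sameSquare-sym sameSquare-trans

totallySymmetricIdempotents : ∀ n →
  ∃ (Count (λ L → IsLatin L × (IsTotallySymmetric ∧ IsIdempotent) L) (SameSquare {n}))
totallySymmetricIdempotents n = classes-exist {P = IsTotallySymmetric ∧ IsIdempotent}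
  (λ L → totallySymmetric? L ×-dec idempotent? L)
  (λ same (t , i) → totallySymmetric-resp same t , idempotent-resp same i)
  sameSquare? (λ same → same) sameSquare-sym sameSquare-trans

isotopic≃paratopic : ∀ {n k} → Count SymmetricUnipotent (Isotopic {n}) k → Count SymmetricUnipotent Paratopic k
isotopic≃paratopic = count-cong
  (λ {_} {L₂} _ _ → isotopic⇒paratopic {L₂ = L₂})
  (λ (_ , sym₁ , _) (lat₂ , sym₂ , _) → paratopic⇒isotopic lat₂ sym₁ sym₂)

isotopic≃rrs : ∀ {n k} → n % 4 ≡ 2 → Count SymmetricUnipotent (Isotopic {n}) k → Count SymmetricUnipotent RRSIsotopic k
isotopic≃rrs n%4≡2 = count-cong
  (λ (lat₁ , sym₁ , uni₁) (lat₂ , sym₂ , uni₂) → isotopic⇒rrs n%4≡2 lat₁ sym₁ uni₁ lat₂ sym₂ uni₂)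
  (λ {_} {L₂} _ _ → rrs⇒isotopic {L₂ = L₂})

theorem8 : (n : ℕ) → 0 < n → 2 ∣ n →
    (∃ λ k → NumClasses n (IsSymmetric ∧ IsUnipotent) Paratopic k
    × NumClasses n (IsSymmetric ∧ IsUnipotent) Isotopic k)
    × (∃ λ k → NumClasses n (IsSymmetric ∧ IsUnipotent) RRSIsotopic k
    × NumOneFactorisationClasses n k)
    × (n % 4 ≡ 2 →
    ∃ λ k → NumClasses n (IsSymmetric ∧ IsUnipotent) Paratopic k
    × NumClasses n (IsSymmetric ∧ IsUnipotent) RRSIsotopic k)
    × (∃ λ k → NumClasses n (IsSymmetric ∧ IsUnipotent ∧ IsReduced) SameSquare k
    × NumClasses (n ∸ 1) (IsSymmetric ∧ IsIdempotent) SameSquare k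
    × NumClasses (n ∸ 1) (IsSymmetric ∧ IsReduced) SameSquare k)
    × (∃ λ k → NumClasses n (IsSymmetric ∧ IsUnipotent) SameSquare ((n !) * k)
    × NumClasses (n ∸ 1) (IsSymmetric ∧ IsReduced) SameSquare k)
    × (∃ λ k → NumClasses n (IsTotallySymmetric ∧ IsUnipotent ∧ IsReduced) SameSquare k
    × NumClasses (n ∸ 1) (IsTotallySymmetric ∧ IsIdempotent) SameSquare k)
    × (∃ λ k → NumClasses n (IsSymmetric ∧ IsUnipotent) Isomorphic k
    × NumClasses (n ∸ 1) IsSymmetric Isomorphic k)
    × (∀ (L : Square n) → IsLatin L → IsSymmetric L → IsUnipotent L →
    (∃ λ L′ → IsLatin L′ × IsSymmetric L′ × IsUnipotent L′ × IsReduced L′ × Paratopic L L′)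
    × (∃ λ L′ → IsLatin L′ × IsSymmetric L′ × IsUnipotent L′ × IsReduced L′ × Isotopic L L′)
    × (∃ λ L′ → IsLatin L′ × IsSymmetric L′ × IsUnipotent L′ × IsReduced L′ × RRSIsotopic L L′))
theorem8 (suc zero) _ 2∣1 = contradiction (∣1⇒≡1 2∣1) λ ()
theorem8 (suc (suc m)) _ 2∣n =
    (let (k , c) = isotopismClasses _ in
       k , count⇒NumClasses (isotopic≃paratopic c) , count⇒NumClasses c)
  , (let (k , c) = rrsIsotopismClasses _ in
       k , count⇒NumClasses c , count⇒NumOneFactorisationClasses (rrs≃oneFactorisations c))
  , (λ n%4≡2 → let (k , c) = isotopismClasses _ in
       k , count⇒NumClasses (isotopic≃paratopic c) , count⇒NumClasses (isotopic≃rrs n%4≡2 c))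
  , (let (k , c) = symmetricIdempotents (suc m) in
       k , count⇒NumClasses (idempotent≃unipotent-reduced c) , count⇒NumClasses c
         , count⇒NumClasses (idempotent≃reduced odd c))
  , (let (k , c) = symmetricIdempotents (suc m) in
       k , count⇒NumClasses (count-symmetricUnipotent (idempotent≃unipotent-reduced c))
         , count⇒NumClasses (idempotent≃reduced odd c))
  , (let (k , c) = totallySymmetricIdempotents (suc m) in
       k , count⇒NumClasses (totallySymmetric-idempotent≃unipotent-reduced c) , count⇒NumClasses c)
  , (let (k , c) = isomorphismClasses (suc m) in
       k , count⇒NumClasses (symmetric≃symmetricUnipotent odd c) , count⇒NumClasses c)
  , λ L lat symL uni →
      let L′ = normalise lat
          lat′ = normalise-latin lat
          sym′ = normalise-symmetric lat symL
          uni′ = normalise-unipotent lat uni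
          red′ = normalise-reduced lat symL
          -- Only symbols are renamed, so the normalised square lies in the same rrs-isotopism
          -- class, hence in the same isotopism class and species.
          rrs : RRSIsotopic L L′
          rrs = Perm.id , flip (row lat zero) , λ _ _ → refl
          iso : Isotopic L L′
          iso = rrs⇒isotopic {L₂ = L′} rrs
      in (L′ , lat′ , sym′ , uni′ , red′ , isotopic⇒paratopic {L₂ = L′} iso)
       , (L′ , lat′ , sym′ , uni′ , red′ , iso)
       , (L′ , lat′ , sym′ , uni′ , red′ , rrs)
  where
  odd : ¬ 2 ∣ suc m
  -- Two consecutive even numbers would make 2 divide 1.
  odd 2∣m = contradiction (∣1⇒≡1 (∣m+n∣m⇒∣n (subst (2 ∣_) (+-comm 1 (suc m)) 2∣n) 2∣m)) λ ()
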